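{- Let $H_n$ be a graph on $n$ vertices with $\delta(H_n)\geq n/2-\eta$, where $1/2\leq\eta=\eta(n)\leq n/64$. (a) If $m=\omega(\eta)$, then a.a.s. $H_n\cup G_{n,m}$ is Hamiltonian. (b) If $\eta=\omega(1)$, $\lambda=\lambda(n)=\omega(\eta^{1/2})$ and $m\geq\frac{2\eta}{1/4-8\eta/n}+\lambda$, then a.a.s. $H_n\cup G_{n,m}$ is Hamiltonian.
   Context: All graphs are simple; $H_n$ denotes a sequence of graphs indexed by $n$. For an integer $m\in[\binom{n}{2}]$, $G_{n,m}$ is the random graph on the same $n$-vertex set as $H_n$ having exactly $m$ edges, chosen uniformly at random among all such graphs; $H_n\cup G_{n,m}$ is the union of edge sets. A graph is Hamiltonian if it contains a cycle through all its vertices. An event holds asymptotically almost surely (a.a.s.) if its probability tends to $1$ as $n\to\infty$. $\delta(\cdot)$ denotes minimum degree; asymptotic notation is as $n\to\infty$.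
   Formalization: The functions η(n) and λ(n) are taken to be rational-valued instead of real-valued. -}

module Defs where

open import Data.Bool using (Bool; true; false; _∨_; _∧_; if_then_else_)
open import Data.Nat as ℕ using (ℕ; zero; suc; _+_; _*_; _∸_; _≤_; _<ᵇ_)
open import Data.Nat.Combinatorics using (_C_)
open import Data.Fin using (Fin; toℕ)
open import Data.Vec as Vec using (Vec; lookup; zipWith)
open import Data.List using (List; []; _∷_; length; map; allFin)
open import Data.Nat.ListAction using (sum)
open import Data.List.Relation.Unary.All using (All)
open import Data.List.Relation.Unary.Unique.Propositional using (Unique)
open import Data.Product using (Σ; ∃; _×_)
open import Data.Unit using (⊤)
open import Data.Integer using (+_)
open import Data.Rational as ℚ using (ℚ; 0ℚ; _÷_)
open import Data.Rational.Properties using (_≟_)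
open import Relation.Binary.PropositionalEquality using (_≡_)
open import Relation.Nullary using (yes; no)

Mat : ℕ → Set
Mat n = Vec (Vec Bool n) n

entry : ∀ {n} → Mat n → Fin n → Fin n → Bool
entry A i j = lookup (lookup A i) j

IsSimple : ∀ {n} → Mat n → Set
IsSimple {n} A = (∀ (i j : Fin n) → entry A i j ≡ entry A j i)
               × (∀ (i : Fin n) → entry A i i ≡ false)

record SimpleGraph (n : ℕ) : Set where
  field
    adj    : Mat n
    simple : IsSimple adj
open SimpleGraph public

Adj : ∀ {n} → Mat n → Fin n → Fin n → Set
Adj A i j = entry A i j ≡ true

_∪ᴳ_ : ∀ {n} → Mat n → Mat n → Mat n
A ∪ᴳ B = zipWith (zipWith _∨_) A B

boolCount : ∀ {k} → Vec Bool k → ℕ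
boolCount Vec.[] = 0
boolCount (true Vec.∷ bs) = suc (boolCount bs)
boolCount (false Vec.∷ bs) = boolCount bs

degree : ∀ {n} → Mat n → Fin n → ℕ
degree A v = boolCount (lookup A v)

edgeCount : ∀ {n} → Mat n → ℕ
edgeCount {n} A =
  sum (map (λ i → sum (map (λ j → if (toℕ i <ᵇ toℕ j) ∧ entry A i j then 1 else 0)
                           (allFin n)))
           (allFin n))

PathFrom : ∀ {n} → Mat n → Fin n → List (Fin n) → Set
PathFrom A x [] = ⊤
PathFrom A x (y ∷ ys) = Adj A x y × PathFrom A y ys

lastOf : ∀ {n} → Fin n → List (Fin n) → Fin n
lastOf x [] = x
lastOf x (y ∷ ys) = lastOf y ys

Hamiltonian : ∀ {n} → Mat n → Set
Hamiltonian {n} A =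
  Σ (Fin n) λ v → Σ (List (Fin n)) λ rest →
    Unique (v ∷ rest) × length (v ∷ rest) ≡ n × 3 ≤ n
    × PathFrom A v rest × Adj A (lastOf v rest) v

-- P(H ∪ G_{n,m} Hamiltonian) ≥ 1 - 1/k :
-- there are at least (1 - 1/k) * binom(binom(n,2), m) distinct graphs G on
-- Fin n with exactly m edges such that H ∪ G is Hamiltonian.
-- (binom(binom(n,2), m) is the number of simple graphs on Fin n with m edges.)
ProbHamAtLeast : ∀ {n} → SimpleGraph n → ℕ → ℕ → Set
ProbHamAtLeast {n} H m k =
  Σ (List (Mat n)) λ L →
    Unique L
    × All (λ G → IsSimple G × edgeCount G ≡ m × Hamiltonian (adj H ∪ᴳ G)) L
    × (k ∸ 1) * ((n C 2) C m) ≤ k * length L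

AAS-Ham : (H : (n : ℕ) → SimpleGraph n) (m : ℕ → ℕ) → Set
AAS-Ham H m = ∀ (k : ℕ) → 1 ≤ k → ∃ λ N → ∀ n → N ≤ n → ProbHamAtLeast (H n) (m n) k

ℕ→ℚ : ℕ → ℚ
ℕ→ℚ a = (+ a) ℚ./ 1

-- division, with the convention x / 0 = 0 (only used with nonzero denominators)
infixl 7 _÷₀_
_÷₀_ : ℚ → ℚ → ℚ
p ÷₀ q with q ≟ 0ℚ
... | yes _ = 0ℚ
... | no q≢0 = _÷_ p q {{ℚ.≢-nonZero q≢0}}

-- f = ω(g) for g eventually positive: f/g → ∞, i.e. for every K, eventually K·g ≤ f.
_isω_ : (ℕ → ℚ) → (ℕ → ℚ) → Set
f isω g = ∀ (K : ℕ) → ∃ λ N → ∀ n → N ≤ n → ℕ→ℚ K ℚ.* g n ℚ.≤ f n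

-- λ = ω(η^{1/2}) (η > 0): for every K, eventually λ ≥ 0 and K²·η ≤ λ²,
-- i.e. λ/√η ≥ K.
_isωSqrt_ : (ℕ → ℚ) → (ℕ → ℚ) → Set
f isωSqrt g = ∀ (K : ℕ) → ∃ λ N → ∀ n → N ≤ n →
  (0ℚ ℚ.≤ f n) × (ℕ→ℚ (K * K) ℚ.* g n ℚ.≤ f n ℚ.* f n)

StandingHyp : ℕ → (H : (n : ℕ) → SimpleGraph n) → (η : ℕ → ℚ) → (m : ℕ → ℕ) → Set
StandingHyp n₀ H η m = ∀ n → n₀ ≤ n →
    (∀ (v : Fin n) → (+ n ℚ./ 2) ℚ.- η n ℚ.≤ ℕ→ℚ (degree (adj (H n)) v))
  × ((+ 1 ℚ./ 2) ℚ.≤ η n)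
  × (η n ℚ.≤ (+ n ℚ./ 64))
  × (1 ≤ m n) × (m n ≤ n C 2)

{-# OPTIONS --safe #-}
module Submission where

-- For an ordering of the vertices let its deficit be the number of cyclically
-- consecutive pairs that are not adjacent, and let d(G) be the least deficit over
-- all orderings, so that G is Hamiltonian iff d(G) = 0.  Let δ be the minimum degree
-- of H.  In an optimal ordering x … y whose closing pair yx is a gap, reversing an
-- initial segment cannot help; counting these exchanges gives
-- deg x + deg y + d(G) ≤ n, hence d(H) ≤ n - 2δ ≤ 2η.  If d(G) > 0 and G ⊇ H, then
-- rotating the ordering at either end turns at least δ² ordered pairs (a, b) into the
-- closing pair without creating gaps, so at least δ²/2 new edges each lower d.
-- Hence d(H ∪ G_{n,m}) is dominated by n - 2δ minus a binomial variable with m trials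
-- and success probability δ²/(n(n-1)) ≥ 1/4 - 8η/n, and Chebyshev's inequality
-- bounds the probability that it is still positive after m edges.

-- The edges are drawn without replacement, so the trials are not independent. After j draws fewer
-- pairs are free, while at least δ²/2 of them still lower d as long as d > 0; the conditional
-- success probability thus never falls below δ²/(n(n-1)). The comparison with independent trials
-- averages the binomial tail itself over the random edge set and trades one drawn edge for one
-- trial at a time. Improving pairs are automatically new: an ordering with d(G) - 1 gaps before
-- closing cannot have an adjacent closing pair. Probabilities are cleared of denominators: they
-- appear as numbers of subsets multiplied by powers of n(n-1). For failure probability 1/k the mean
-- number of successes has to exceed 2η by a margin w with w ≥ 2k and w² ≥ 4kη, so that 1/w and
-- 2η/w² are each at most 1/(2k). Part (a) takes w = 8kη; in part (b) the summand λ in the bound on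
-- m pays for w = λ/8.

open import Defs
open import Data.Nat as ℕ using (ℕ; zero; suc; z≤n; s≤s)
open import Data.Integer as ℤ using (ℤ; 0ℤ)
import Data.Integer.Properties as ℤₚ
open import Data.Rational as ℚ using (ℚ; 0ℚ; 1ℚ)
import Data.Rational.Properties as ℚₚ
open import Data.Product using (Σ; ∃; ∃₂; _×_; _,_; proj₁; proj₂)
open import Data.Sum using (inj₁; inj₂)
open import Function using (_∘_; const; id)
open import Relation.Nullary using (¬_; Dec; yes; no; does; contradiction)
open import Relation.Nullary.Decidable using (map′; _×-dec_)
open import Relation.Binary.PropositionalEquality

-- Rational arithmetic

module RationalArithmetic where

  open import Data.Rational using (_≤_; _+_; _*_; _-_; toℚᵘ)
  import Data.Nat.Properties as ℕₚ
  import Data.Rational.Unnormalised as ℚᵘ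
  import Data.Rational.Unnormalised.Properties as ℚᵘₚ
  open import Data.Rational.Solver using (module +-*-Solver)
  open +-*-Solver using (solve; _:+_; _:*_; _:-_; _:=_; con)

  ι : ℕ → ℚ
  ι = ℕ→ℚ

  toℚᵘ-/ : ∀ a d → toℚᵘ (ℤ.+ a ℚ./ suc d) ℚᵘ.≃ ℚᵘ.mkℚᵘ (ℤ.+ a) d
  toℚᵘ-/ a d = ℚₚ.toℚᵘ-fromℚᵘ (ℚᵘ.mkℚᵘ (ℤ.+ a) d)

  ι-+ : ∀ a b → ι (a ℕ.+ b) ≡ ι a + ι b
  ι-+ a b = ℚₚ.toℚᵘ-injective (begin
    toℚᵘ (ι (a ℕ.+ b))                                ≈⟨ toℚᵘ-/ (a ℕ.+ b) 0 ⟩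
    ℚᵘ.mkℚᵘ (ℤ.+ (a ℕ.+ b)) 0                         ≈⟨ ℚᵘ.*≡* (cong (ℤ._* ℤ.+ 1) (cong₂ ℤ._+_ (sym (ℤₚ.*-identityʳ (ℤ.+ a))) (sym (ℤₚ.*-identityʳ (ℤ.+ b))))) ⟩
    ℚᵘ.mkℚᵘ (ℤ.+ a) 0 ℚᵘ.+ ℚᵘ.mkℚᵘ (ℤ.+ b) 0          ≈⟨ ℚᵘₚ.+-cong (toℚᵘ-/ a 0) (toℚᵘ-/ b 0) ⟨
    toℚᵘ (ι a) ℚᵘ.+ toℚᵘ (ι b)                        ≈⟨ ℚₚ.toℚᵘ-homo-+ (ι a) (ι b) ⟨
    toℚᵘ (ι a + ι b)                                  ∎)
    where open ℚᵘₚ.≃-Reasoning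

  ι-* : ∀ a b → ι (a ℕ.* b) ≡ ι a * ι b
  ι-* a b = ℚₚ.toℚᵘ-injective (begin
    toℚᵘ (ι (a ℕ.* b))                                ≈⟨ toℚᵘ-/ (a ℕ.* b) 0 ⟩
    ℚᵘ.mkℚᵘ (ℤ.+ (a ℕ.* b)) 0                         ≈⟨ ℚᵘ.*≡* (cong (ℤ._* ℤ.+ 1) (ℤₚ.pos-* a b)) ⟩
    ℚᵘ.mkℚᵘ (ℤ.+ a) 0 ℚᵘ.* ℚᵘ.mkℚᵘ (ℤ.+ b) 0          ≈⟨ ℚᵘₚ.*-cong (toℚᵘ-/ a 0) (toℚᵘ-/ b 0) ⟨
    toℚᵘ (ι a) ℚᵘ.* toℚᵘ (ι b)                        ≈⟨ ℚₚ.toℚᵘ-homo-* (ι a) (ι b) ⟨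
    toℚᵘ (ι a * ι b)                                  ∎)
    where open ℚᵘₚ.≃-Reasoning

  /≡*1/ : ∀ a d → ℤ.+ a ℚ./ suc d ≡ ι a * (ℤ.+ 1 ℚ./ suc d)
  /≡*1/ a d = ℚₚ.toℚᵘ-injective (begin
    toℚᵘ (ℤ.+ a ℚ./ suc d)                            ≈⟨ toℚᵘ-/ a d ⟩
    ℚᵘ.mkℚᵘ (ℤ.+ a) d                                 ≈⟨ ℚᵘ.*≡* (cong₂ ℤ._*_ (sym (ℤₚ.*-identityʳ (ℤ.+ a))) (cong (λ z → ℤ.+ suc z) (ℕₚ.+-identityʳ d))) ⟩
    ℚᵘ.mkℚᵘ (ℤ.+ a) 0 ℚᵘ.* ℚᵘ.mkℚᵘ (ℤ.+ 1) d          ≈⟨ ℚᵘₚ.*-cong (toℚᵘ-/ a 0) (toℚᵘ-/ 1 d) ⟨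
    toℚᵘ (ι a) ℚᵘ.* toℚᵘ (ℤ.+ 1 ℚ./ suc d)            ≈⟨ ℚₚ.toℚᵘ-homo-* (ι a) (ℤ.+ 1 ℚ./ suc d) ⟨
    toℚᵘ (ι a * (ℤ.+ 1 ℚ./ suc d))                    ∎)
    where open ℚᵘₚ.≃-Reasoning

  ι-mono : ∀ {a b} → a ℕ.≤ b → ι a ≤ ι b
  ι-mono {a} {b} a≤b = ℚₚ.toℚᵘ-cancel-≤ (begin
    toℚᵘ (ι a)          ≃⟨ toℚᵘ-/ a 0 ⟩
    ℚᵘ.mkℚᵘ (ℤ.+ a) 0   ≤⟨ ℚᵘ.*≤* (ℤₚ.*-monoʳ-≤-nonNeg (ℤ.+ 1) (ℤ.+≤+ a≤b)) ⟩
    ℚᵘ.mkℚᵘ (ℤ.+ b) 0   ≃⟨ toℚᵘ-/ b 0 ⟨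
    toℚᵘ (ι b)          ∎)
    where open ℚᵘₚ.≤-Reasoning

  ι-cancel : ∀ {a b} → ι a ≤ ι b → a ℕ.≤ b
  ι-cancel {a} {b} h = ℤₚ.drop‿+≤+ (ℤₚ.*-cancelʳ-≤-pos (ℤ.+ a) (ℤ.+ b) (ℤ.+ 1) (ℚᵘₚ.drop-*≤* (begin
    ℚᵘ.mkℚᵘ (ℤ.+ a) 0   ≃⟨ toℚᵘ-/ a 0 ⟨
    toℚᵘ (ι a)          ≤⟨ ℚₚ.toℚᵘ-mono-≤ h ⟩
    toℚᵘ (ι b)          ≃⟨ toℚᵘ-/ b 0 ⟩
    ℚᵘ.mkℚᵘ (ℤ.+ b) 0   ∎)))
    where open ℚᵘₚ.≤-Reasoning

  p≤q⇒0≤q-p : ∀ {p q} → p ≤ q → 0ℚ ≤ q - p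
  p≤q⇒0≤q-p {p} {q} p≤q = ℚₚ.≤-trans (ℚₚ.≤-reflexive (sym (ℚₚ.+-inverseʳ p))) (ℚₚ.+-monoˡ-≤ (ℚ.- p) p≤q)

  -- Inequalities are proved by writing the difference as a nonnegative expression.
  ≤-by : ∀ {p q r} → 0ℚ ≤ r → q ≡ p + r → p ≤ q
  ≤-by {p} {q} {r} 0≤r q≡p+r = begin
    p         ≡⟨ ℚₚ.+-identityʳ p ⟨
    p + 0ℚ    ≤⟨ ℚₚ.+-monoʳ-≤ p 0≤r ⟩
    p + r     ≡⟨ q≡p+r ⟨
    q         ∎
    where open ℚₚ.≤-Reasoning

  0≤+ : ∀ {p q} → 0ℚ ≤ p → 0ℚ ≤ q → 0ℚ ≤ p + q
  0≤+ 0≤p 0≤q = ℚₚ.+-mono-≤ 0≤p 0≤q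

  0≤* : ∀ {p q} → 0ℚ ≤ p → 0ℚ ≤ q → 0ℚ ≤ p * q
  0≤* {p} {q} 0≤p 0≤q =
    ℚₚ.nonNegative⁻¹ (p * q) {{ℚₚ.nonNeg*nonNeg⇒nonNeg p {{ℚ.nonNegative 0≤p}} q {{ℚ.nonNegative 0≤q}}}}

  *-mono : ∀ {p q r s} → 0ℚ ≤ p → 0ℚ ≤ r → p ≤ q → r ≤ s → p * r ≤ q * s
  *-mono {p} {q} {r} {s} 0≤p 0≤r p≤q r≤s = ≤-by
    (0≤+ (0≤* (p≤q⇒0≤q-p p≤q) 0≤r) (0≤* (ℚₚ.≤-trans 0≤p p≤q) (p≤q⇒0≤q-p r≤s)))
    (solve 4 (λ p q r s → q :* s := p :* r :+ ((q :- p) :* r :+ q :* (s :- r))) refl p q r s)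

  ÷₀-* : ∀ p {q} → q ≢ 0ℚ → (p ÷₀ q) * q ≡ p
  ÷₀-* p {q} q≢0 with q ℚₚ.≟ 0ℚ
  ... | yes q≡0 = contradiction q≡0 q≢0
  ... | no q≢0′ = trans (ℚₚ.*-assoc p _ q) (trans (cong (p *_) (ℚₚ.*-inverseˡ q {{ℚ.≢-nonZero q≢0′}})) (ℚₚ.*-identityʳ p))

  ½ ¼ ⅛ 1/64 2ℚ 4ℚ 8ℚ 16ℚ 32ℚ 64ℚ : ℚ
  ½    = ℤ.+ 1 ℚ./ 2
  ¼    = ℤ.+ 1 ℚ./ 4
  ⅛    = ℤ.+ 1 ℚ./ 8
  1/64 = ℤ.+ 1 ℚ./ 64
  2ℚ   = ℤ.+ 2 ℚ./ 1
  4ℚ   = ℤ.+ 4 ℚ./ 1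
  8ℚ   = ℤ.+ 8 ℚ./ 1
  16ℚ  = ℤ.+ 16 ℚ./ 1
  32ℚ  = ℤ.+ 32 ℚ./ 1
  64ℚ  = ℤ.+ 64 ℚ./ 1

  0≤ι : ∀ a → 0ℚ ≤ ι a
  0≤ι a = ι-mono {0} {a} z≤n

  0≤2ℚ : 0ℚ ≤ 2ℚ
  0≤2ℚ = 0≤ι 2

  -- By `enough` the expected number of successes is at least 2e + w, whereas at most
  -- 2e are needed; the failure probability is then at most (2e + w) / w² ≤ 1 / k.
  module _ (n δ m k M : ℕ) (e w : ℚ) (1≤k : 1 ℕ.≤ k)
    (M+n : M ℕ.+ n ≡ n ℕ.* n) (1≤M : 1 ℕ.≤ M)
    (deg : ι n * ½ - e ≤ ι δ) (0≤e : 0ℚ ≤ e) (e≤ : e ≤ ι n * ½)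
    (2k≤w : 2ℚ * ι k ≤ w) (4ke≤w² : 4ℚ * ι k * e ≤ w * w)
    (enough : ι n * (2ℚ * e + w) ≤ (ι n * ¼ - 8ℚ * e) * ι m) where

    private
      N Δ μ κ μ′ G : ℚ
      N = ι n
      Δ = ι δ
      μ = ι m
      κ = ι k
      μ′ = ι M
      G = Δ * Δ
      D = n ℕ.∸ 2 ℕ.* δ

      0≤w : 0ℚ ≤ w
      0≤w = ℚₚ.≤-trans (0≤* 0≤2ℚ (0≤ι k)) 2k≤w

      -- The square of n/2 - e is n²/4 - ne + e², so the coefficient 8 leaves the slack 7ne + e².
      -- Squaring `deg` requires n/2 - e to be nonnegative.
      G-bound : N * (N * ¼ - 8ℚ * e) ≤ G
      G-bound = ℚₚ.≤-trans
        (≤-by (0≤+ (0≤* (0≤* (0≤ι 7) (0≤ι n)) 0≤e) (0≤* 0≤e 0≤e))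
          (solve 2 (λ N e → (N :* con ½ :- e) :* (N :* con ½ :- e)
                     := N :* (N :* con ¼ :- con 8ℚ :* e) :+ (con (ι 7) :* N :* e :+ e :* e)) refl N e))
        (*-mono 0≤h 0≤h deg deg)
        where
        0≤h : 0ℚ ≤ N * ½ - e
        0≤h = p≤q⇒0≤q-p e≤

      N²≡ : N * N ≡ μ′ + N
      N²≡ = trans (sym (ι-* n n)) (trans (cong ι (sym M+n)) (ι-+ M n))

      -- Since M = n² - n is at most n², it suffices to multiply `enough` by n and apply `G-bound`.
      Gm-bound : μ′ * (2ℚ * e + w) ≤ G * μ
      Gm-bound = begin
        μ′ * (2ℚ * e + w)                    ≤⟨ ≤-by (0≤* (0≤ι n) 0≤x) (trans (cong (_* x) N²≡) (ℚₚ.*-distribʳ-+ x μ′ N)) ⟩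
        N * N * x                            ≡⟨ ℚₚ.*-assoc N N x ⟩
        N * (N * x)                          ≤⟨ *-mono (0≤ι n) (0≤* (0≤ι n) 0≤x) ℚₚ.≤-refl enough ⟩
        N * ((N * ¼ - 8ℚ * e) * μ)           ≡⟨ ℚₚ.*-assoc N _ μ ⟨
        N * (N * ¼ - 8ℚ * e) * μ             ≤⟨ ℚₚ.*-monoʳ-≤-nonNeg μ {{ℚ.nonNegative (0≤ι m)}} G-bound ⟩
        G * μ                                ∎
        where
        open ℚₚ.≤-Reasoning
        x = 2ℚ * e + w
        0≤x : 0ℚ ≤ x
        0≤x = 0≤+ (0≤* 0≤2ℚ 0≤e) 0≤w

      Y : ℚ
      Y = G * μ - 2ℚ * e * μ′

      Y-bound : μ′ * w ≤ Y
      Y-bound = ≤-by (p≤q⇒0≤q-p Gm-bound)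
        (solve 5 (λ G μ e μ′ w → G :* μ :- con 2ℚ :* e :* μ′
                   := μ′ :* w :+ (G :* μ :- μ′ :* (con 2ℚ :* e :+ w))) refl G μ e μ′ w)

      Y≥2kM : 2ℚ * κ * μ′ ≤ Y
      Y≥2kM = ℚₚ.≤-trans (ℚₚ.≤-trans (*-mono (0≤* 0≤2ℚ (0≤ι k)) (0≤ι M) 2k≤w ℚₚ.≤-refl) (ℚₚ.≤-reflexive (ℚₚ.*-comm w μ′))) Y-bound

      0≤Y : 0ℚ ≤ Y
      0≤Y = ℚₚ.≤-trans (0≤* (0≤ι M) 0≤w) Y-bound

      Y²≥4keM² : 4ℚ * κ * e * (μ′ * μ′) ≤ Y * Y
      Y²≥4keM² = ℚₚ.≤-trans (*-mono (0≤* (0≤* (0≤ι 4) (0≤ι k)) 0≤e) (0≤* (0≤ι M) (0≤ι M)) 4ke≤w² ℚₚ.≤-refl)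
        (ℚₚ.≤-trans (ℚₚ.≤-reflexive (solve 2 (λ w μ′ → w :* w :* (μ′ :* μ′) := μ′ :* w :* (μ′ :* w)) refl w μ′))
          (*-mono (0≤* (0≤ι M) 0≤w) (0≤* (0≤ι M) 0≤w) Y-bound Y-bound))

      -- Because Gμ = Y + 2eμ′, the left side is κμ′Y + 2κeμ′². Each summand is at most Y²/2, the
      -- first by `Y≥2kM` and the second by `Y²≥4keM²`.
      kMGm≤Y² : κ * (G * μ′ * μ) ≤ Y * Y
      kMGm≤Y² = ≤-by
        (0≤+ (0≤* (ℚₚ.nonNegative⁻¹ ½) (0≤* 0≤Y (p≤q⇒0≤q-p Y≥2kM))) (0≤* (ℚₚ.nonNegative⁻¹ ½) (p≤q⇒0≤q-p Y²≥4keM²)))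
        (solve 5 (λ G μ e μ′ κ → let Y = G :* μ :- con 2ℚ :* e :* μ′ in
           Y :* Y := κ :* (G :* μ′ :* μ)
                     :+ (con ½ :* (Y :* (Y :- con 2ℚ :* κ :* μ′)) :+ con ½ :* (Y :* Y :- con 4ℚ :* κ :* e :* (μ′ :* μ′)))) refl G μ e μ′ κ)

      D≤2e : ι D ≤ 2ℚ * e
      D≤2e with ℕₚ.≤-total n (2 ℕ.* δ)
      ... | inj₁ n≤2δ = ℚₚ.≤-trans (ℚₚ.≤-reflexive (cong ι (ℕₚ.m≤n⇒m∸n≡0 n≤2δ))) (0≤* 0≤2ℚ 0≤e)
      ... | inj₂ 2δ≤n = ≤-by (0≤* 0≤2ℚ (p≤q⇒0≤q-p deg)) (begin
        2ℚ * e                                        ≡⟨ solve 3 (λ N Δ e → con 2ℚ :* e := (N :- con 2ℚ :* Δ) :+ con 2ℚ :* (Δ :- (N :* con ½ :- e))) refl N Δ e ⟩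
        (N - 2ℚ * Δ) + 2ℚ * (Δ - (N * ½ - e))         ≡⟨ cong (_+ 2ℚ * (Δ - (N * ½ - e))) N-2Δ ⟩
        ι D + 2ℚ * (Δ - (N * ½ - e))                  ∎)
        where
        open ≡-Reasoning
        N-2Δ : N - 2ℚ * Δ ≡ ι D
        N-2Δ = begin
          N - 2ℚ * Δ                     ≡⟨ cong (λ z → ι z - 2ℚ * Δ) (ℕₚ.m∸n+n≡m 2δ≤n) ⟨
          ι (D ℕ.+ 2 ℕ.* δ) - 2ℚ * Δ     ≡⟨ cong (_- 2ℚ * Δ) (trans (ι-+ D (2 ℕ.* δ)) (cong (ι D +_) (ι-* 2 δ))) ⟩
          ι D + 2ℚ * Δ - 2ℚ * Δ          ≡⟨ solve 2 (λ d x → d :+ x :- x := d) refl (ι D) (2ℚ * Δ) ⟩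
          ι D                            ∎

      ι-Gm : ι (δ ℕ.* δ ℕ.* m) ≡ G * μ
      ι-Gm = trans (ι-* (δ ℕ.* δ) m) (cong (_* μ) (ι-* δ δ))

      DM≤Gm : D ℕ.* M ℕ.≤ δ ℕ.* δ ℕ.* m
      DM≤Gm = ι-cancel (begin
        ι (D ℕ.* M)          ≡⟨ ι-* D M ⟩
        ι D * μ′             ≤⟨ *-mono (0≤ι D) (0≤ι M) D≤2e ℚₚ.≤-refl ⟩
        2ℚ * e * μ′          ≤⟨ ≤-by 0≤Y (solve 2 (λ a b → a := b :+ (a :- b)) refl (G * μ) (2ℚ * e * μ′)) ⟩
        G * μ                ≡⟨ ι-Gm ⟨
        ι (δ ℕ.* δ ℕ.* m)    ∎)
        where open ℚₚ.≤-Reasoning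

      s = δ ℕ.* δ ℕ.* m ℕ.∸ D ℕ.* M

      s-eq : δ ℕ.* δ ℕ.* m ≡ D ℕ.* M ℕ.+ s
      s-eq = sym (ℕₚ.m+[n∸m]≡n DM≤Gm)

      Y≤s : Y ≤ ι s
      Y≤s = ≤-by (0≤* (p≤q⇒0≤q-p D≤2e) (0≤ι M)) (begin
        ι s                                       ≡⟨ solve 2 (λ s x → s := x :+ s :- x) refl (ι s) (ι D * μ′) ⟩
        ι D * μ′ + ι s - ι D * μ′                 ≡⟨ cong (_- ι D * μ′) Gm≡ ⟨
        G * μ - ι D * μ′                          ≡⟨ solve 5 (λ G μ e μ′ d → G :* μ :- d :* μ′ := (G :* μ :- con 2ℚ :* e :* μ′) :+ (con 2ℚ :* e :- d) :* μ′) refl G μ e μ′ (ι D) ⟩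
        Y + (2ℚ * e - ι D) * μ′                   ∎)
        where
        open ≡-Reasoning
        Gm≡ : G * μ ≡ ι D * μ′ + ι s
        Gm≡ = trans (sym ι-Gm) (trans (cong ι s-eq) (trans (ι-+ (D ℕ.* M) s) (cong (_+ ι s) (ι-* D M))))

    -- Here `s / M` is the excess of the mean number of successes δ²m/M over the n - 2δ that are
    -- needed. The last component is the Chebyshev condition: the variance, at most δ²m/M, is at
    -- most a k-th part of the squared excess.
    trials-suffice : ∃ λ s → δ ℕ.* δ ℕ.* m ≡ (n ℕ.∸ 2 ℕ.* δ) ℕ.* M ℕ.+ s × 1 ℕ.≤ s
                       × k ℕ.* (δ ℕ.* δ ℕ.* M ℕ.* m) ℕ.≤ s ℕ.* s
    trials-suffice = s , s-eq
      , ℕₚ.≤-trans (ℕₚ.*-mono-≤ (ℕₚ.*-mono-≤ (s≤s {0} {1} z≤n) 1≤k) 1≤M)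
          (ι-cancel (ℚₚ.≤-trans (ℚₚ.≤-reflexive (trans (ι-* (2 ℕ.* k) M) (cong (_* μ′) (ι-* 2 k)))) (ℚₚ.≤-trans Y≥2kM Y≤s)))
      , ι-cancel (begin
          ι (k ℕ.* (δ ℕ.* δ ℕ.* M ℕ.* m))      ≡⟨ trans (ι-* k _) (cong (κ *_) (trans (ι-* (δ ℕ.* δ ℕ.* M) m) (cong (_* μ) (trans (ι-* (δ ℕ.* δ) M) (cong (_* μ′) (ι-* δ δ)))))) ⟩
          κ * (G * μ′ * μ)                     ≤⟨ kMGm≤Y² ⟩
          Y * Y                                ≤⟨ *-mono 0≤Y 0≤Y Y≤s Y≤s ⟩
          ι s * ι s                            ≡⟨ ι-* s s ⟨
          ι (s ℕ.* s)                          ∎)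
      where open ℚₚ.≤-Reasoning

  -- Margins that suffice under the two hypotheses on the number of edges

  module _ (N μ κ e : ℚ) (0≤N : 0ℚ ≤ N) (1≤κ : 1ℚ ≤ κ) (½≤e : ½ ≤ e) (e≤N/64 : e ≤ N * 1/64) where

    private
      0≤e : 0ℚ ≤ e
      0≤e = ℚₚ.≤-trans (ℚₚ.nonNegative⁻¹ ½) ½≤e

      0≤κ : 0ℚ ≤ κ
      0≤κ = ℚₚ.≤-trans (0≤ι 1) 1≤κ

    e≤N/2 : e ≤ N * ½
    e≤N/2 = ℚₚ.≤-trans e≤N/64 (*-mono 0≤N (ℚₚ.nonNegative⁻¹ 1/64) ℚₚ.≤-refl
                                (≤-by {1/64} {½} (ℚₚ.nonNegative⁻¹ (ℤ.+ 31 ℚ./ 64)) refl))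

    -- The bound n/64 on η enters here: 8e costs at most half of n/4, which leaves a success
    -- probability of at least 1/8.
    N/8≤ : N * ⅛ ≤ N * ¼ - 8ℚ * e
    N/8≤ = ≤-by (0≤* (0≤ι 8) (p≤q⇒0≤q-p e≤N/64))
      (solve 2 (λ N e → N :* con ¼ :- con 8ℚ :* e := N :* con ⅛ :+ con 8ℚ :* (N :* con 1/64 :- e)) refl N e)

    2κ≤8κe : 2ℚ * κ ≤ 8ℚ * κ * e
    2κ≤8κe = ≤-by (0≤+ (0≤* 0≤2ℚ 0≤κ) (0≤* (0≤* (0≤ι 8) 0≤κ) (p≤q⇒0≤q-p ½≤e)))
      (solve 2 (λ κ e → con 8ℚ :* κ :* e := con 2ℚ :* κ :+ (con 2ℚ :* κ :+ con 8ℚ :* κ :* (e :- con ½))) refl κ e)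

    4κe≤[8κe]² : 4ℚ * κ * e ≤ 8ℚ * κ * e * (8ℚ * κ * e)
    4κe≤[8κe]² = ℚₚ.≤-trans
      (≤-by (0≤+ (0≤* (0≤* (0≤ι 4) 0≤κ) 0≤e) (0≤* (0≤* (0≤* (0≤ι 8) 0≤κ) 0≤e) (p≤q⇒0≤q-p 1≤κ)))
        (solve 2 (λ κ e → con 8ℚ :* κ :* e :* κ := con 4ℚ :* κ :* e :+ (con 4ℚ :* κ :* e :+ con 8ℚ :* κ :* e :* (κ :- con 1ℚ))) refl κ e))
      (*-mono (0≤* (0≤* (0≤ι 8) 0≤κ) 0≤e) 0≤κ ℚₚ.≤-refl
        (ℚₚ.≤-trans (≤-by 0≤κ (solve 1 (λ κ → con 2ℚ :* κ := κ :+ κ) refl κ)) 2κ≤8κe))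

    -- With margin w = 8κe and success probability at least 1/8, the number of edges has to reach
    -- 8(2e + w), which is (64κ + 16)e.
    enough-linear : (64ℚ * κ + 16ℚ) * e ≤ μ → N * (2ℚ * e + 8ℚ * κ * e) ≤ (N * ¼ - 8ℚ * e) * μ
    enough-linear Ke≤μ = begin
      N * (2ℚ * e + 8ℚ * κ * e)          ≡⟨ solve 3 (λ N κ e → N :* (con 2ℚ :* e :+ con 8ℚ :* κ :* e)
                                              := N :* con ⅛ :* ((con 64ℚ :* κ :+ con 16ℚ) :* e)) refl N κ e ⟩
      N * ⅛ * ((64ℚ * κ + 16ℚ) * e)      ≤⟨ *-mono (0≤* 0≤N (ℚₚ.nonNegative⁻¹ ⅛))
                                              (0≤* (0≤+ (0≤* (0≤ι 64) 0≤κ) (0≤ι 16)) 0≤e) N/8≤ Ke≤μ ⟩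
      (N * ¼ - 8ℚ * e) * μ               ∎
      where open ℚₚ.≤-Reasoning

    module _ (l : ℚ) (0≤l : 0ℚ ≤ l) (K²e≤l² : 32ℚ * κ * (32ℚ * κ) * e ≤ l * l) where

      private
        w = ⅛ * l

        0≤w : 0ℚ ≤ w
        0≤w = 0≤* (ℚₚ.nonNegative⁻¹ ⅛) 0≤l

        16κ²e≤w² : 16ℚ * κ * κ * e ≤ w * w
        16κ²e≤w² = ≤-by (0≤* (ℚₚ.nonNegative⁻¹ 1/64) (p≤q⇒0≤q-p K²e≤l²))
          (solve 3 (λ κ e l → con ⅛ :* l :* (con ⅛ :* l) := con 16ℚ :* κ :* κ :* e
                     :+ con 1/64 :* (l :* l :- con 32ℚ :* κ :* (con 32ℚ :* κ) :* e)) refl κ e l)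

      4κe≤[l/8]² : 4ℚ * κ * e ≤ w * w
      4κe≤[l/8]² = ℚₚ.≤-trans
        (≤-by (0≤+ (0≤* (0≤* (0≤ι 12) 0≤κ) 0≤e) (0≤* (0≤* (0≤* (0≤ι 16) 0≤κ) 0≤e) (p≤q⇒0≤q-p 1≤κ)))
          (solve 2 (λ κ e → con 16ℚ :* κ :* κ :* e := con 4ℚ :* κ :* e
                     :+ (con (ι 12) :* κ :* e :+ con 16ℚ :* κ :* e :* (κ :- con 1ℚ))) refl κ e))
        16κ²e≤w²

      -- Otherwise 16κ²e ≤ w² ≤ 4κ², whereas e ≥ 1/2 makes 16κ²e at least 8κ².
      2κ≤l/8 : 2ℚ * κ ≤ w
      2κ≤l/8 with ℚₚ.≤-total (2ℚ * κ) w
      ... | inj₁ 2κ≤w = 2κ≤w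
      ... | inj₂ w≤2κ = contradiction (begin
        1ℚ * 1ℚ                             ≤⟨ *-mono (0≤ι 1) (0≤ι 1) 1≤κ 1≤κ ⟩
        κ * κ                               ≤⟨ ≤-by (0≤+ (0≤* (0≤ι 3) (0≤* 0≤κ 0≤κ)) (0≤* (0≤* (0≤* (0≤ι 16) 0≤κ) 0≤κ) (p≤q⇒0≤q-p ½≤e)))
                                                 (solve 2 (λ κ e → con 16ℚ :* κ :* κ :* e :- con 2ℚ :* κ :* (con 2ℚ :* κ)
                                                   := κ :* κ :+ (con (ι 3) :* (κ :* κ) :+ con 16ℚ :* κ :* κ :* (e :- con ½))) refl κ e) ⟩
        16ℚ * κ * κ * e - 2ℚ * κ * (2ℚ * κ) ≤⟨ ℚₚ.+-monoˡ-≤ (ℚ.- (2ℚ * κ * (2ℚ * κ))) (ℚₚ.≤-trans 16κ²e≤w² (*-mono 0≤w 0≤w w≤2κ w≤2κ)) ⟩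
        2ℚ * κ * (2ℚ * κ) - 2ℚ * κ * (2ℚ * κ) ≡⟨ ℚₚ.+-inverseʳ (2ℚ * κ * (2ℚ * κ)) ⟩
        0ℚ                                  ∎) λ { (ℚ.*≤* (ℤ.+≤+ ())) }
        where open ℚₚ.≤-Reasoning

      -- Here p stands for 1/4 - 8e/n and q for 2e/p. The first q edges contribute qp = 2e expected
      -- successes, and the remaining l contribute pl, at least the margin l/8.
      enough-sqrt : ∀ p q → N * p ≡ N * ¼ - 8ℚ * e → ⅛ ≤ p → q * p ≡ 2ℚ * e → q + l ≤ μ →
        N * (2ℚ * e + w) ≤ (N * ¼ - 8ℚ * e) * μ
      enough-sqrt p q N*p ⅛≤p q*p q+l≤μ = begin
        N * (2ℚ * e + w)                    ≤⟨ *-mono 0≤N (0≤+ (0≤* 0≤2ℚ 0≤e) 0≤w) ℚₚ.≤-refl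
                                                (ℚₚ.+-monoʳ-≤ (2ℚ * e) (*-mono (ℚₚ.nonNegative⁻¹ ⅛) 0≤l ⅛≤p ℚₚ.≤-refl)) ⟩
        N * (2ℚ * e + p * l)                ≡⟨ cong (λ z → N * (z + p * l)) q*p ⟨
        N * (q * p + p * l)                 ≡⟨ solve 4 (λ N q p l → N :* (q :* p :+ p :* l) := N :* p :* (q :+ l)) refl N q p l ⟩
        N * p * (q + l)                     ≡⟨ cong (_* (q + l)) N*p ⟩
        (N * ¼ - 8ℚ * e) * (q + l)          ≤⟨ ℚₚ.*-monoˡ-≤-nonNeg (N * ¼ - 8ℚ * e) {{ℚ.nonNegative
                                                (ℚₚ.≤-trans (0≤* 0≤N (ℚₚ.nonNegative⁻¹ ⅛)) N/8≤)}} q+l≤μ ⟩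
        (N * ¼ - 8ℚ * e) * μ                ∎
        where open ℚₚ.≤-Reasoning

    ⅛≤p : N ≢ 0ℚ → ∀ p → N * p ≡ N * ¼ - 8ℚ * e → ⅛ ≤ p
    ⅛≤p N≢0 p N*p = ℚₚ.*-cancelˡ-≤-pos N {{ℚₚ.nonNeg∧nonZero⇒pos N {{ℚ.nonNegative 0≤N}} {{ℚ.≢-nonZero N≢0}}}}
                      (ℚₚ.≤-trans N/8≤ (ℚₚ.≤-reflexive (sym N*p)))

  ⅛≤p⇒p≢0 : ∀ {p} → ⅛ ≤ p → p ≢ 0ℚ
  ⅛≤p⇒p≢0 ⅛≤0 refl with ℚ.*≤* (ℤ.+≤+ ()) ← ⅛≤0

  *-[¼-x] : ∀ N x y → x * N ≡ y → N * (¼ - x) ≡ N * ¼ - y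
  *-[¼-x] N x y x*N = trans (solve 2 (λ N x → N :* (con ¼ :- x) := N :* con ¼ :- x :* N) refl N x)
                            (cong (λ z → N * ¼ - z) x*N)

open import Data.Bool using (Bool; true; false; if_then_else_; _∧_; _∨_)
open import Data.Bool.Properties using (∨-zeroʳ)
open import Data.Nat using (_+_; _*_; _∸_; _^_; _≤_; _≤?_; _<ᵇ_; _⊔_; NonZero; >-nonZero)
open import Data.Nat.Properties hiding (_≟_)
open import Data.Nat.Combinatorics using (_C_; nCk+nC[k+1]≡[n+1]C[k+1]; nC1≡n)
open import Data.Nat.Tactic.RingSolver using (solve-∀)
import Data.Nat.ListAction as ℕList
open import Data.Nat.ListAction.Properties using (sum-↭)
import Data.Integer.Tactic.RingSolver as ℤSolver
open import Data.Fin using (Fin; zero; suc; _↑ˡ_; _↑ʳ_; splitAt; toℕ; fromℕ<)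
open import Data.Fin.Properties using (any?; _≟_; splitAt⁻¹-↑ˡ; splitAt⁻¹-↑ʳ)
open import Data.Vec using (Vec; []; _∷_; lookup; _[_]≔_; tabulate; zipWith; replicate)
open import Data.Vec.Properties using (lookup∘tabulate; lookup-zipWith; tabulate-cong; tabulate∘lookup; lookup∘update; lookup∘update′)
open import Data.Vec.Functional using (Vector)
open import Data.List as List using (List; []; _∷_; length; _++_; reverse; allFin)
open import Data.List.Properties using (length-++; length-map; length-tabulate; map-tabulate; unfold-reverse)
open import Data.List.Membership.Propositional using (_∈_)
open import Data.List.Membership.Propositional.Properties using (∈-map⁻; ∈-∃++)
open import Data.List.Membership.DecPropositional using (_∈?_)
open import Data.List.Relation.Unary.Any using (here; there)
open import Data.List.Relation.Unary.All as All using (All; []; _∷_)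
import Data.List.Relation.Unary.All.Properties as Allₚ
open import Data.List.Relation.Unary.AllPairs using ([]; _∷_)
open import Data.List.Relation.Unary.Unique.Propositional using (Unique)
import Data.List.Relation.Unary.Unique.Propositional.Properties as Uniqueₚ
open import Data.List.Relation.Binary.Permutation.Propositional using (_↭_; ↭-sym; ↭-trans; ↭-refl; prep; ↭⇒↭ₛ)
open import Data.List.Relation.Binary.Permutation.Propositional.Properties using (drop-∷; ∈-resp-↭; ¬x∷xs↭[]; ↭-length; ↭-reverse; ++⁺; ++-comm; shift; map⁺)
import Data.List.Relation.Binary.Permutation.Setoid.Properties as Permₚ
open import Data.Unit using (tt)
open import Algebra.Properties.Semiring.Sum +-*-semiring using (sum; sum-cong-≗; *-distribʳ-sum; ∑-distrib-+)

-- Averaging over the subsets of a given size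

sum-mono : ∀ {n} {f g : Vector ℕ n} → (∀ i → f i ≤ g i) → sum f ≤ sum g
sum-mono {zero}  f≤g = z≤n
sum-mono {suc n} f≤g = +-mono-≤ (f≤g zero) (sum-mono (f≤g ∘ suc))

sum-split : ∀ m {n} (f : Vector ℕ (m + n)) →
            sum f ≡ sum (λ i → f (i ↑ˡ n)) + sum (λ j → f (m ↑ʳ j))
sum-split zero    f = refl
sum-split (suc m) f =
  trans (cong (f zero +_) (sum-split m (f ∘ suc))) (sym (+-assoc (f zero) _ _))

-- Splitting on the first position follows Pascal's rule, so that counting subsets and double
-- counting their extensions are plain inductions.
sumSubsets : ∀ N → ℕ → (Vec Bool N → ℕ) → ℕ
sumSubsets zero    zero    f = f []
sumSubsets zero    (suc j) f = 0
sumSubsets (suc N) zero    f = sumSubsets N zero (f ∘ (false ∷_))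
sumSubsets (suc N) (suc j) f =
  sumSubsets N j (f ∘ (true ∷_)) + sumSubsets N (suc j) (f ∘ (false ∷_))

sumSubsets-mono : ∀ N j {f g : Vec Bool N → ℕ} →
                  (∀ S → boolCount S ≡ j → f S ≤ g S) → sumSubsets N j f ≤ sumSubsets N j g
sumSubsets-mono zero    zero    f≤g = f≤g [] refl
sumSubsets-mono zero    (suc j) f≤g = z≤n
sumSubsets-mono (suc N) zero    f≤g = sumSubsets-mono N zero (λ S → f≤g (false ∷ S))
sumSubsets-mono (suc N) (suc j) f≤g =
  +-mono-≤ (sumSubsets-mono N j (λ S eq → f≤g (true ∷ S) (cong suc eq)))
           (sumSubsets-mono N (suc j) (λ S → f≤g (false ∷ S)))

sumSubsets-cong : ∀ N j {f g : Vec Bool N → ℕ} →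
                  (∀ S → boolCount S ≡ j → f S ≡ g S) → sumSubsets N j f ≡ sumSubsets N j g
sumSubsets-cong N j f≡g = ≤-antisym
  (sumSubsets-mono N j (λ S eq → ≤-reflexive (f≡g S eq)))
  (sumSubsets-mono N j (λ S eq → ≤-reflexive (sym (f≡g S eq))))

sumSubsets-+ : ∀ N j (f g : Vec Bool N → ℕ) →
               sumSubsets N j (λ S → f S + g S) ≡ sumSubsets N j f + sumSubsets N j g
sumSubsets-+ zero    zero    f g = refl
sumSubsets-+ zero    (suc j) f g = refl
sumSubsets-+ (suc N) zero    f g = sumSubsets-+ N zero _ _
sumSubsets-+ (suc N) (suc j) f g =
  trans (cong₂ _+_ (sumSubsets-+ N j _ _) (sumSubsets-+ N (suc j) _ _))
        (+-middleFour (sumSubsets N j _) _ _ _)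
  where
  +-middleFour : ∀ a b c d → (a + b) + (c + d) ≡ (a + c) + (b + d)
  +-middleFour = solve-∀

sumSubsets-* : ∀ N j c (f : Vec Bool N → ℕ) →
               sumSubsets N j (λ S → c * f S) ≡ c * sumSubsets N j f
sumSubsets-* zero    zero    c f = refl
sumSubsets-* zero    (suc j) c f = sym (*-zeroʳ c)
sumSubsets-* (suc N) zero    c f = sumSubsets-* N zero c _
sumSubsets-* (suc N) (suc j) c f =
  trans (cong₂ _+_ (sumSubsets-* N j c _) (sumSubsets-* N (suc j) c _))
        (sym (*-distribˡ-+ c (sumSubsets N j _) _))

count : ∀ N → ℕ → ℕ
count N j = sumSubsets N j (const 1)

count-C : ∀ N j → count N j ≡ N C j
count-C zero    zero    = refl
count-C zero    (suc j) = refl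
count-C (suc N) zero    = count-C N zero
count-C (suc N) (suc j) =
  trans (cong₂ _+_ (count-C N j) (count-C N (suc j))) (nCk+nC[k+1]≡[n+1]C[k+1] N j)

sumExtensions : ∀ {N} → (Vec Bool N → ℕ) → Vec Bool N → ℕ
sumExtensions f S = sum λ e → if lookup S e then 0 else f (S [ e ]≔ true)

-- Every (j+1)-subset is an extension of exactly j+1 of its j-subsets.
sumSubsets-extensions : ∀ N j (f : Vec Bool N → ℕ) →
  sumSubsets N j (sumExtensions f) ≡ suc j * sumSubsets N (suc j) f
sumSubsets-extensions zero    zero    f = refl
sumSubsets-extensions zero    (suc j) f = sym (*-zeroʳ j)
sumSubsets-extensions (suc N) zero    f =
  trans (sumSubsets-+ N 0 (f ∘ (true ∷_)) _)
  (trans (cong (sumSubsets N 0 (f ∘ (true ∷_)) +_)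
            (trans (sumSubsets-extensions N 0 (f ∘ (false ∷_))) (+-identityʳ _)))
         (sym (+-identityʳ _)))
sumSubsets-extensions (suc N) (suc j) f =
  trans (cong₂ _+_ (sumSubsets-extensions N j (f ∘ (true ∷_)))
          (trans (sumSubsets-+ N (suc j) (f ∘ (true ∷_)) _)
                 (cong (sumSubsets N (suc j) (f ∘ (true ∷_)) +_)
                       (sumSubsets-extensions N (suc j) (f ∘ (false ∷_))))))
        (regroup j (sumSubsets N (suc j) _) (sumSubsets N (suc (suc j)) _))
  where
  regroup : ∀ j a b → suc j * a + (a + suc (suc j) * b) ≡ suc (suc j) * (a + b)
  regroup = solve-∀

sumExtensions-1 : ∀ {N} (S : Vec Bool N) → sumExtensions (const 1) S + boolCount S ≡ N
sumExtensions-1 []          = refl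
sumExtensions-1 (true ∷ S)  = trans (+-suc _ _) (cong suc (sumExtensions-1 S))
sumExtensions-1 (false ∷ S) = cong suc (sumExtensions-1 S)

sumExtensions-free : ∀ {N j} (S : Vec Bool N) → boolCount S ≡ j → sumExtensions (const 1) S ≡ N ∸ j
sumExtensions-free S refl =
  sym (trans (cong (_∸ boolCount S) (sym (sumExtensions-1 S))) (m+n∸n≡m _ (boolCount S)))

count-suc : ∀ N j → suc j * count N (suc j) ≡ (N ∸ j) * count N j
count-suc N j = begin
  suc j * count N (suc j)                    ≡⟨ sumSubsets-extensions N j (const 1) ⟨
  sumSubsets N j (sumExtensions (const 1))   ≡⟨ sumSubsets-cong N j (λ S eq → trans (sumExtensions-free S eq) (sym (*-identityʳ _))) ⟩
  sumSubsets N j (λ _ → (N ∸ j) * 1)         ≡⟨ sumSubsets-* N j (N ∸ j) (const 1) ⟩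
  (N ∸ j) * count N j                        ∎
  where open ≡-Reasoning

sumSubsets-empty : ∀ N f → sumSubsets N 0 f ≡ f (replicate N false)
sumSubsets-empty zero    f = refl
sumSubsets-empty (suc N) f = sumSubsets-empty N _

indicator : {P : Set} → Dec P → ℕ
indicator P? = if does P? then 1 else 0

-- `ProbHamAtLeast` asks for an explicit list of distinct graphs; this converts a count of subsets
-- into such a list.
listSubsets : ∀ N j {P : Vec Bool N → Set} (P? : ∀ S → Dec (P S)) →
  Σ (List (Vec Bool N)) λ L → Unique L × All (λ S → boolCount S ≡ j × P S) L
    × length L ≡ sumSubsets N j (λ S → indicator (P? S))
listSubsets zero zero P? with P? []
... | yes p = [] ∷ [] , [] ∷ [] , (refl , p) ∷ [] , refl
... | no _  = [] , [] , [] , refl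
listSubsets zero (suc j) P? = [] , [] , [] , refl
listSubsets (suc N) zero P? with listSubsets N zero (P? ∘ (false ∷_))
... | L , u , a , eq =
  List.map (false ∷_) L , Uniqueₚ.map⁺ (λ { refl → refl }) u , Allₚ.map⁺ a
  , trans (length-map _ L) eq
listSubsets (suc N) (suc j) P?
  with listSubsets N j (P? ∘ (true ∷_)) | listSubsets N (suc j) (P? ∘ (false ∷_))
... | L₁ , u₁ , a₁ , eq₁ | L₂ , u₂ , a₂ , eq₂ =
  List.map (true ∷_) L₁ List.++ List.map (false ∷_) L₂
  , Uniqueₚ.++⁺ (Uniqueₚ.map⁺ (λ { refl → refl }) u₁) (Uniqueₚ.map⁺ (λ { refl → refl }) u₂) disjoint
  , Allₚ.++⁺ (Allₚ.map⁺ (All.map (λ (b , p) → cong suc b , p) a₁)) (Allₚ.map⁺ a₂)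
  , trans (length-++ (List.map (true ∷_) L₁))
          (cong₂ _+_ (trans (length-map _ L₁) eq₁) (trans (length-map _ L₂) eq₂))
  where
  disjoint : ∀ {S} → ¬ (S ∈ List.map (true ∷_) L₁ × S ∈ List.map (false ∷_) L₂)
  disjoint (p , q) with ∈-map⁻ (true ∷_) p | ∈-map⁻ (false ∷_) q
  ... | _ , _ , refl | _ , _ , ()

-- Graphs as subsets of the set of vertex pairs

-- Recursive rather than `n C 2`, so that the index set of the pairs splits into the first row and
-- the rest, as `tri` requires.
pairs : ℕ → ℕ
pairs zero    = 0
pairs (suc n) = n + pairs n

pairs-C : ∀ n → pairs n ≡ n C 2
pairs-C zero    = refl
pairs-C (suc n) =
  trans (cong₂ _+_ (sym (nC1≡n n)) (pairs-C n)) (nCk+nC[k+1]≡[n+1]C[k+1] n 1)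

2*pairs : ∀ n → 2 * pairs n + n ≡ n * n
2*pairs zero    = refl
2*pairs (suc n) = begin
  2 * (n + pairs n) + suc n     ≡⟨ regroup n (pairs n) ⟩
  suc (n + n + (2 * pairs n + n)) ≡⟨ cong (λ z → suc (n + n + z)) (2*pairs n) ⟩
  suc (n + n + n * n)           ≡⟨ square n ⟨
  suc n * suc n                 ∎
  where
  open ≡-Reasoning
  regroup : ∀ n p → 2 * (n + p) + suc n ≡ suc (n + n + (2 * p + n))
  regroup = solve-∀
  square : ∀ n → suc n * suc n ≡ suc (n + n + n * n)
  square = solve-∀

1≤2*pairs : ∀ {n} → 3 ≤ n → 1 ≤ 2 * pairs n
1≤2*pairs {suc (suc n)} _        = s≤s z≤n
1≤2*pairs {suc zero}    (s≤s ())

-- The symmetric array with constant diagonal x whose entries above the diagonal,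
-- read row by row, are F.
tri : ∀ {A : Set} {n} → A → (Fin (pairs n) → A) → Fin n → Fin n → A
tri               x F zero    zero    = x
tri {n = suc n}   x F zero    (suc j) = F (j ↑ˡ pairs n)
tri {n = suc n}   x F (suc i) zero    = F (i ↑ˡ pairs n)
tri {n = suc n}   x F (suc i) (suc j) = tri x (λ e → F (n ↑ʳ e)) i j

tri-diag : ∀ {A : Set} {n} (x : A) F (i : Fin n) → tri x F i i ≡ x
tri-diag x F zero            = refl
tri-diag {n = suc n} x F (suc i) = tri-diag x _ i

tri-sym : ∀ {A : Set} {n} (x : A) F (i j : Fin n) → tri x F i j ≡ tri x F j i
tri-sym x F zero    zero    = refl
tri-sym x F zero    (suc j) = refl
tri-sym x F (suc i) zero    = refl
tri-sym {n = suc n} x F (suc i) (suc j) = tri-sym x _ i j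

-- The equation holds for all `A`, `x` and `F` at once because one index has to serve both the
-- Boolean adjacency and the numerical weights on pairs.
tri-index : ∀ {n} (i j : Fin n) → i ≢ j →
  Σ (Fin (pairs n)) λ e → ∀ {A : Set} (x : A) F → tri x F i j ≡ F e
tri-index zero    zero    i≢j = contradiction refl i≢j
tri-index {suc n} zero    (suc j) i≢j = j ↑ˡ pairs n , λ x F → refl
tri-index {suc n} (suc i) zero    i≢j = i ↑ˡ pairs n , λ x F → refl
tri-index {suc n} (suc i) (suc j) i≢j with tri-index i j (i≢j ∘ cong suc)
... | e , eq = n ↑ʳ e , λ x F → eq x (λ e → F (n ↑ʳ e))

tri-onto : ∀ {n} (e : Fin (pairs n)) →
  Σ (Fin n) λ i → Σ (Fin n) λ j → ∀ {A : Set} (x : A) F → tri x F i j ≡ F e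
tri-onto {suc n} e with splitAt n e in eq
... | inj₁ j = zero , suc j , λ x F → cong F (splitAt⁻¹-↑ˡ eq)
... | inj₂ e′ with tri-onto e′
...   | i , j , eq′ = suc i , suc j , λ x F → trans (eq′ x _) (cong F (splitAt⁻¹-↑ʳ eq))

-- Passage from ordered pairs, which rotations count, to edges; the factor 2 in `d-drops` comes from
-- here.
sum-tri : ∀ n (F : Fin (pairs n) → ℕ) → sum (λ (i : Fin n) → sum (tri 0 F i)) ≡ 2 * sum F
sum-tri zero    F = refl
sum-tri (suc n) F = begin
  sum Fˡ + sum (λ i → Fˡ i + sum (tri 0 Fʳ i))          ≡⟨ cong (sum Fˡ +_) (∑-distrib-+ Fˡ (λ i → sum (tri 0 Fʳ i))) ⟩
  sum Fˡ + (sum Fˡ + sum {n} (λ i → sum (tri 0 Fʳ i)))  ≡⟨ cong (λ z → sum Fˡ + (sum Fˡ + z)) (sum-tri n Fʳ) ⟩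
  sum Fˡ + (sum Fˡ + 2 * sum Fʳ)                        ≡⟨ regroup (sum Fˡ) (sum Fʳ) ⟩
  2 * (sum Fˡ + sum Fʳ)                                 ≡⟨ cong (2 *_) (sum-split n F) ⟨
  2 * sum F                                             ∎
  where
  open ≡-Reasoning
  Fˡ : Fin n → ℕ
  Fˡ i = F (i ↑ˡ pairs n)
  Fʳ : Fin (pairs n) → ℕ
  Fʳ e = F (n ↑ʳ e)
  regroup : ∀ a b → a + (a + 2 * b) ≡ 2 * (a + b)
  regroup = solve-∀

toMat : ∀ n → Vec Bool (pairs n) → Mat n
toMat n S = tabulate λ i → tabulate (tri false (lookup S) i)

entry-toMat : ∀ n (S : Vec Bool (pairs n)) i j → entry (toMat n S) i j ≡ tri false (lookup S) i j
entry-toMat n S i j =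
  trans (cong (λ row → lookup row j) (lookup∘tabulate _ i)) (lookup∘tabulate _ j)

toMat-simple : ∀ n (S : Vec Bool (pairs n)) → IsSimple (toMat n S)
toMat-simple n S =
    (λ i j → trans (entry-toMat n S i j) (trans (tri-sym false (lookup S) i j) (sym (entry-toMat n S j i))))
  , (λ i → trans (entry-toMat n S i i) (tri-diag false (lookup S) i))

toMat-injective : ∀ n {S S′ : Vec Bool (pairs n)} → toMat n S ≡ toMat n S′ → S ≡ S′
toMat-injective n {S} {S′} eq =
  trans (sym (tabulate∘lookup S)) (trans (tabulate-cong same) (tabulate∘lookup S′))
  where
  same : ∀ e → lookup S e ≡ lookup S′ e
  same e with tri-onto {n} e
  ... | i , j , at = begin
    lookup S e                    ≡⟨ at false (lookup S) ⟨
    tri false (lookup S) i j      ≡⟨ entry-toMat n S i j ⟨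
    entry (toMat n S) i j         ≡⟨ cong (λ M → entry M i j) eq ⟩
    entry (toMat n S′) i j        ≡⟨ entry-toMat n S′ i j ⟩
    tri false (lookup S′) i j     ≡⟨ at false (lookup S′) ⟩
    lookup S′ e                   ∎
    where open ≡-Reasoning

boolCount-sum : ∀ {k} (v : Vec Bool k) → boolCount v ≡ sum (λ i → if lookup v i then 1 else 0)
boolCount-sum []          = refl
boolCount-sum (true ∷ v)  = cong suc (boolCount-sum v)
boolCount-sum (false ∷ v) = boolCount-sum v

sum-map-allFin : ∀ {n} (f : Fin n → ℕ) → ℕList.sum (List.map f (List.allFin n)) ≡ sum f
sum-map-allFin {n} f = trans (cong ℕList.sum (map-tabulate id f)) (sum-tabulate f)
  where
  sum-tabulate : ∀ {n} (f : Fin n → ℕ) → ℕList.sum (List.tabulate f) ≡ sum f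
  sum-tabulate {zero}  f = refl
  sum-tabulate {suc n} f = cong (f zero +_) (sum-tabulate (f ∘ suc))

edgeCount-toMat : ∀ n (S : Vec Bool (pairs n)) → edgeCount (toMat n S) ≡ boolCount S
edgeCount-toMat n S = begin
  edgeCount (toMat n S)                                ≡⟨ sum-map-allFin {n} _ ⟩
  sum {n} (λ i → ℕList.sum (List.map (cell (entry (toMat n S)) i) (List.allFin n)))
    ≡⟨ sum-cong-≗ {n} (λ i → sum-map-allFin {n} _) ⟩
  sum {n} (λ i → sum {n} (cell (entry (toMat n S)) i))
    ≡⟨ sum-cong-≗ {n} (λ i → sum-cong-≗ {n} λ j →
         cong (λ b → if (toℕ i <ᵇ toℕ j) ∧ b then 1 else 0) (entry-toMat n S i j)) ⟩
  sum {n} (λ i → sum {n} (cell (tri false (lookup S)) i))  ≡⟨ upper-sum n (lookup S) ⟩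
  sum (λ e → if lookup S e then 1 else 0)              ≡⟨ boolCount-sum S ⟨
  boolCount S                                          ∎
  where
  open ≡-Reasoning
  cell : ∀ {n} → (Fin n → Fin n → Bool) → Fin n → Fin n → ℕ
  cell A i j = if (toℕ i <ᵇ toℕ j) ∧ A i j then 1 else 0
  upper-sum : ∀ n (F : Fin (pairs n) → Bool) →
    sum {n} (λ i → sum {n} (cell (tri false F) i)) ≡ sum (λ e → if F e then 1 else 0)
  upper-sum zero    F = refl
  upper-sum (suc n) F =
    trans (cong (sum (λ j → if F (j ↑ˡ pairs n) then 1 else 0) +_) (upper-sum n (λ e → F (n ↑ʳ e))))
          (sym (sum-split n (λ e → if F e then 1 else 0)))

entry-∪ : ∀ {n} (A B : Mat n) i j → entry (A ∪ᴳ B) i j ≡ entry A i j ∨ entry B i j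
entry-∪ A B i j =
  trans (cong (λ row → lookup row j) (lookup-zipWith (zipWith _∨_) i A B))
        (lookup-zipWith _∨_ j (lookup A i) (lookup B i))

-- Orderings of the vertices and their gaps

least : {P : ℕ → Set} → (∀ c → Dec (P c)) → ∀ b → P b → ∃ λ d → P d × (∀ c → P c → d ≤ c)
least P? b pb with P? 0
least P? b       pb | yes p0 = 0 , p0 , λ _ _ → z≤n
least P? zero    pb | no ¬p0 = contradiction pb ¬p0
least P? (suc b) pb | no ¬p0 with least (P? ∘ suc) b pb
... | d , pd , d-least =
  suc d , pd , λ { zero p → contradiction p ¬p0 ; (suc c) p → s≤s (d-least c p) }

anyList? : ∀ {n} k {P : List (Fin n) → Set} → (∀ ℓ → Dec (P ℓ)) →
           Dec (∃ λ ℓ → length ℓ ≡ k × P ℓ)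
anyList? zero    P? = map′ (λ p → [] , refl , p) (λ { ([] , refl , p) → p }) (P? [])
anyList? (suc k) P? =
  map′ (λ (x , ℓ , eq , p) → x ∷ ℓ , cong suc eq , p)
       (λ { (x ∷ ℓ , refl , p) → x , ℓ , refl , p })
       (any? λ x → anyList? k (P? ∘ (x ∷_)))

_↭?_ : ∀ {n} (xs ys : List (Fin n)) → Dec (xs ↭ ys)
[] ↭? []       = yes ↭-refl
[] ↭? (y ∷ ys) = no (¬x∷xs↭[] ∘ ↭-sym)
(x ∷ xs) ↭? ys with _∈?_ _≟_ x ys
... | no x∉ys = no λ p → x∉ys (∈-resp-↭ p (here refl))
... | yes x∈ys with ∈-∃++ x∈ys
...   | us , vs , refl =
  map′ (λ p → ↭-trans (prep x p) (↭-sym (shift x us vs)))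
       (λ p → drop-∷ (↭-trans p (shift x us vs)))
       (xs ↭? (us ++ vs))

-- Lists with known end points and sums over consecutive pairs

module _ {V : Set} where

  -- The end points are indices, so that concatenation and reversal show directly which consecutive
  -- pairs appear or disappear.
  data Seg : V → V → List V → Set where
    [_]ˢ : ∀ x → Seg x x (x ∷ [])
    _∷ˢ_ : ∀ x {w y ℓ} → Seg w y ℓ → Seg x y (x ∷ ℓ)

  adjSum : (V → V → ℕ) → List V → ℕ
  adjSum F []           = 0
  adjSum F (x ∷ [])     = 0
  adjSum F (x ∷ y ∷ zs) = F x y + adjSum F (y ∷ zs)

  private variable
    x y a w : V
    ℓ ℓ₁ ℓ₂ : List V

  adjSum-∷ : ∀ F x → Seg w y ℓ → adjSum F (x ∷ ℓ) ≡ F x w + adjSum F ℓ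
  adjSum-∷ F x [ _ ]ˢ   = refl
  adjSum-∷ F x (_ ∷ˢ _) = refl

  Seg-++ : Seg x a ℓ₁ → Seg w y ℓ₂ → Seg x y (ℓ₁ ++ ℓ₂)
  Seg-++ [ x ]ˢ    t = x ∷ˢ t
  Seg-++ (x ∷ˢ s)  t = x ∷ˢ Seg-++ s t

  adjSum-++ : ∀ F → Seg x a ℓ₁ → Seg w y ℓ₂ →
              adjSum F (ℓ₁ ++ ℓ₂) ≡ adjSum F ℓ₁ + F a w + adjSum F ℓ₂
  adjSum-++ F [ x ]ˢ t = adjSum-∷ F x t
  adjSum-++ {w = w} {ℓ₂ = ℓ₂} F (_∷ˢ_ x {v} {a} {ℓ₁} s) t = begin
    adjSum F (x ∷ ℓ₁ ++ ℓ₂)                             ≡⟨ adjSum-∷ F x (Seg-++ s t) ⟩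
    F x v + adjSum F (ℓ₁ ++ ℓ₂)                         ≡⟨ cong (F x v +_) (adjSum-++ F s t) ⟩
    F x v + (adjSum F ℓ₁ + F a w + adjSum F ℓ₂)         ≡⟨ assoc (F x v) _ _ _ ⟩
    F x v + adjSum F ℓ₁ + F a w + adjSum F ℓ₂           ≡⟨ cong (λ z → z + F a w + adjSum F ℓ₂) (adjSum-∷ F x s) ⟨
    adjSum F (x ∷ ℓ₁) + F a w + adjSum F ℓ₂             ∎
    where
    open ≡-Reasoning
    assoc : ∀ p q r s → p + (q + r + s) ≡ p + q + r + s
    assoc = solve-∀

  Seg-reverse : Seg x y ℓ → Seg y x (reverse ℓ)
  Seg-reverse [ x ]ˢ = [ x ]ˢ
  Seg-reverse (_∷ˢ_ x {ℓ = ℓ} s) =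
    subst (Seg _ x) (sym (unfold-reverse x ℓ)) (Seg-++ (Seg-reverse s) [ x ]ˢ)

  adjSum-reverse : ∀ F → (∀ u v → F u v ≡ F v u) → Seg x y ℓ → adjSum F (reverse ℓ) ≡ adjSum F ℓ
  adjSum-reverse F F-sym [ x ]ˢ = refl
  adjSum-reverse F F-sym (_∷ˢ_ x {w} {y} {ℓ} s) = begin
    adjSum F (reverse (x ∷ ℓ))              ≡⟨ cong (adjSum F) (unfold-reverse x ℓ) ⟩
    adjSum F (reverse ℓ ++ x ∷ [])          ≡⟨ adjSum-++ F (Seg-reverse s) [ x ]ˢ ⟩
    adjSum F (reverse ℓ) + F w x + 0        ≡⟨ +-identityʳ _ ⟩
    adjSum F (reverse ℓ) + F w x            ≡⟨ cong₂ _+_ (adjSum-reverse F F-sym s) (F-sym w x) ⟩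
    adjSum F ℓ + F x w                      ≡⟨ +-comm (adjSum F ℓ) _ ⟩
    F x w + adjSum F ℓ                      ≡⟨ adjSum-∷ F x s ⟨
    adjSum F (x ∷ ℓ)                        ∎
    where open ≡-Reasoning

  -- The comparison is asked only at actual junctions and comes with the split of the list there:
  -- the exchange arguments reverse one of the two parts.
  adjSum-mono : ∀ F G → Seg x y ℓ →
    (∀ {a w ℓ₁ ℓ₂} → Seg x a ℓ₁ → Seg w y ℓ₂ → ℓ ≡ ℓ₁ ++ ℓ₂ → F a w ≤ G a w) →
    adjSum F ℓ ≤ adjSum G ℓ
  adjSum-mono F G [ x ]ˢ   F≤G = z≤n
  adjSum-mono F G (_∷ˢ_ x {w} {ℓ = ℓ} s) F≤G = begin
    adjSum F (x ∷ ℓ)    ≡⟨ adjSum-∷ F x s ⟩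
    F x w + adjSum F ℓ  ≤⟨ +-mono-≤ (F≤G [ x ]ˢ s refl)
                             (adjSum-mono F G s λ s₁ s₂ eq → F≤G (x ∷ˢ s₁) s₂ (cong (x ∷_) eq)) ⟩
    G x w + adjSum G ℓ  ≡⟨ adjSum-∷ G x s ⟨
    adjSum G (x ∷ ℓ)    ∎
    where open ≤-Reasoning

  adjSum-+ : ∀ F G ℓ → adjSum (λ u v → F u v + G u v) ℓ ≡ adjSum F ℓ + adjSum G ℓ
  adjSum-+ F G []           = refl
  adjSum-+ F G (x ∷ [])     = refl
  adjSum-+ F G (x ∷ y ∷ zs) =
    trans (cong (F x y + G x y +_) (adjSum-+ F G (y ∷ zs))) (middle (F x y) _ _ _)
    where
    middle : ∀ p q r s → p + q + (r + s) ≡ p + r + (q + s)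
    middle = solve-∀

  listSum : (V → ℕ) → List V → ℕ
  listSum f ℓ = ℕList.sum (List.map f ℓ)

  -- Every entry but the first is the right member of exactly one consecutive pair. This turns the
  -- degree of the first vertex into a sum over junctions; `adjSum-left` does the same for the last
  -- vertex.
  adjSum-right : ∀ f → Seg x y ℓ → f x + adjSum (λ _ v → f v) ℓ ≡ listSum f ℓ
  adjSum-right f [ x ]ˢ   = refl
  adjSum-right f (x ∷ˢ s) = cong (f x +_) (trans (adjSum-∷ _ x s) (adjSum-right f s))

  adjSum-left : ∀ f → Seg x y ℓ → f y + adjSum (λ u _ → f u) ℓ ≡ listSum f ℓ
  adjSum-left f [ x ]ˢ = refl
  adjSum-left {y = y} f (_∷ˢ_ x {ℓ = ℓ} s) = begin
    f y + adjSum (λ u _ → f u) (x ∷ ℓ)        ≡⟨ cong (f y +_) (adjSum-∷ (λ u _ → f u) x s) ⟩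
    f y + (f x + adjSum (λ u _ → f u) ℓ)      ≡⟨ exchange (f y) (f x) _ ⟩
    f x + (f y + adjSum (λ u _ → f u) ℓ)      ≡⟨ cong (f x +_) (adjSum-left f s) ⟩
    f x + listSum f ℓ                         ∎
    where
    open ≡-Reasoning
    exchange : ∀ p q r → p + (q + r) ≡ q + (p + r)
    exchange = solve-∀

  adjSum-positive : ∀ F → Seg x y ℓ → 1 ≤ adjSum F ℓ →
    ∃₂ λ a w → ∃₂ λ ℓ₁ ℓ₂ → Seg x a ℓ₁ × Seg w y ℓ₂ × ℓ ≡ ℓ₁ ++ ℓ₂ × 1 ≤ F a w
  adjSum-positive F [ x ]ˢ ()
  adjSum-positive F (_∷ˢ_ x {w} {ℓ = ℓ} s) pos with 1 ≤? F x w
  ... | yes F≥1 = x , w , x ∷ [] , ℓ , [ x ]ˢ , s , refl , F≥1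
  ... | no  F<1 with adjSum-positive F s
                       (subst (1 ≤_) (trans (adjSum-∷ F x s) (cong (_+ adjSum F ℓ) (n<1⇒n≡0 (≰⇒> F<1)))) pos)
  ...   | a , w , ℓ₁ , ℓ₂ , s₁ , s₂ , eq , F≥1 = a , w , x ∷ ℓ₁ , ℓ₂ , x ∷ˢ s₁ , s₂ , cong (x ∷_) eq , F≥1

  Seg-last∈ : Seg x y ℓ → y ∈ ℓ
  Seg-last∈ [ x ]ˢ   = here refl
  Seg-last∈ (x ∷ˢ s) = there (Seg-last∈ s)

  Seg-ends-distinct : Seg x y ℓ → Unique ℓ → 2 ≤ length ℓ → x ≢ y
  Seg-ends-distinct [ x ]ˢ   u       (s≤s ())
  Seg-ends-distinct (x ∷ˢ s) (x∉ ∷ _) _ = All.lookup x∉ (Seg-last∈ s)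

Seg-lastOf : ∀ {n} (x : Fin n) ys → Seg x (lastOf x ys) (x ∷ ys)
Seg-lastOf x []       = [ x ]ˢ
Seg-lastOf x (y ∷ ys) = x ∷ˢ Seg-lastOf y ys

edge gap : Bool → ℕ
edge b = if b then 1 else 0
gap  b = if b then 0 else 1

gap≤1 : ∀ b → gap b ≤ 1
gap≤1 true  = z≤n
gap≤1 false = ≤-refl

-- Minimum deficit, exchanges and rotations

module Orderings {n : ℕ} where

  Ordering : List (Fin n) → Set
  Ordering ℓ = ℓ ↭ allFin n

  listSum-ordering : ∀ f {ℓ} → Ordering ℓ → listSum f ℓ ≡ sum f
  listSum-ordering f p = trans (sum-↭ (map⁺ f p)) (sum-map-allFin f)

  Ordering-reverseˡ : ∀ ℓ₁ ℓ₂ → Ordering (ℓ₁ ++ ℓ₂) → Ordering (reverse ℓ₁ ++ ℓ₂)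
  Ordering-reverseˡ ℓ₁ ℓ₂ p = ↭-trans (++⁺ (↭-reverse ℓ₁) ↭-refl) p

  Ordering-reverseʳ : ∀ ℓ₁ ℓ₂ → Ordering (ℓ₁ ++ ℓ₂) → Ordering (ℓ₁ ++ reverse ℓ₂)
  Ordering-reverseʳ ℓ₁ ℓ₂ p = ↭-trans (++⁺ ↭-refl (↭-reverse ℓ₂)) p

  gaps : (Fin n → Fin n → Bool) → List (Fin n) → ℕ
  gaps A = adjSum (λ u v → gap (A u v))

  deficit : (Fin n → Fin n → Bool) → List (Fin n) → ℕ
  deficit A []       = 0
  deficit A (x ∷ xs) = gaps A (x ∷ xs) + gap (A (lastOf x xs) x)

  Seg-first≡ : ∀ {x y z} {xs : List (Fin n)} → Seg x y (z ∷ xs) → z ≡ x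
  Seg-first≡ [ x ]ˢ   = refl
  Seg-first≡ (x ∷ˢ _) = refl

  Seg-last≡ : ∀ {x y z} {xs : List (Fin n)} → Seg x y (z ∷ xs) → lastOf z xs ≡ y
  Seg-last≡ [ x ]ˢ                 = refl
  Seg-last≡ (_∷ˢ_ x {ℓ = _ ∷ _} s) = Seg-last≡ s

  deficit-Seg : ∀ A {x y ℓ} → Seg x y ℓ → deficit A ℓ ≡ gaps A ℓ + gap (A y x)
  deficit-Seg A {ℓ = z ∷ zs} s =
    cong₂ (λ y x → gaps A (z ∷ zs) + gap (A y x)) (Seg-last≡ s) (Seg-first≡ s)

  HasDeficit : (Fin n → Fin n → Bool) → ℕ → Set
  HasDeficit A c = ∃ λ ℓ → Ordering ℓ × deficit A ℓ ≤ c

  -- Orderings have length n, so an exhaustive search decides this; the minimum deficit is thereby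
  -- computed without classical reasoning.
  hasDeficit? : ∀ A c → Dec (HasDeficit A c)
  hasDeficit? A c =
    map′ (λ (ℓ , _ , p) → ℓ , p)
         (λ (ℓ , o , p) → ℓ , trans (↭-length o) (length-tabulate id) , o , p)
         (anyList? n λ ℓ → (ℓ ↭? allFin n) ×-dec (deficit A ℓ ≤? c))

  private
    leastDeficit : ∀ A → ∃ λ d → HasDeficit A d × (∀ c → HasDeficit A c → d ≤ c)
    leastDeficit A = least (hasDeficit? A) (deficit A (allFin n)) (allFin n , ↭-refl , ≤-refl)

  minDeficit : (Fin n → Fin n → Bool) → ℕ
  minDeficit A = proj₁ (leastDeficit A)

  minDeficit-attained : ∀ A → HasDeficit A (minDeficit A)
  minDeficit-attained A = proj₁ (proj₂ (leastDeficit A))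

  minDeficit-least : ∀ A {c} → HasDeficit A c → minDeficit A ≤ c
  minDeficit-least A = proj₂ (proj₂ (leastDeficit A)) _

  deg : (Fin n → Fin n → Bool) → Fin n → ℕ
  deg A v = sum (λ w → edge (A v w))

  gap-antitone : ∀ {b b′} → (b ≡ true → b′ ≡ true) → gap b′ ≤ gap b
  gap-antitone {true}  b⇒b′ rewrite b⇒b′ refl = z≤n
  gap-antitone {false} {b′} b⇒b′ = gap≤1 b′

  gaps-antitone : ∀ {A B} → (∀ u v → A u v ≡ true → B u v ≡ true) → ∀ ℓ → gaps B ℓ ≤ gaps A ℓ
  gaps-antitone A⊆B []           = z≤n
  gaps-antitone A⊆B (x ∷ [])     = z≤n
  gaps-antitone A⊆B (x ∷ y ∷ ys) = +-mono-≤ (gap-antitone (A⊆B x y)) (gaps-antitone A⊆B (y ∷ ys))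

  deficit-antitone : ∀ {A B} → (∀ u v → A u v ≡ true → B u v ≡ true) → ∀ ℓ → deficit B ℓ ≤ deficit A ℓ
  deficit-antitone A⊆B []       = z≤n
  deficit-antitone A⊆B (x ∷ xs) = +-mono-≤ (gaps-antitone A⊆B (x ∷ xs)) (gap-antitone (A⊆B _ x))

  minDeficit-antitone : ∀ {A B} → (∀ u v → A u v ≡ true → B u v ≡ true) → minDeficit B ≤ minDeficit A
  minDeficit-antitone {A} {B} A⊆B with minDeficit-attained A
  ... | ℓ , o , d = minDeficit-least B (ℓ , o , ≤-trans (deficit-antitone A⊆B ℓ) d)

  module _ (A : Fin n → Fin n → Bool)
           (A-sym : ∀ u v → A u v ≡ A v u) (A-irrefl : ∀ u → A u u ≡ false) where

    gap-sym : ∀ u v → gap (A u v) ≡ gap (A v u)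
    gap-sym u v = cong gap (A-sym u v)

    -- Symmetry of `A` preserves the gaps inside the reversed part, so only the junction changes,
    -- from `a w` to `x w`.
    gaps-reverseˡ : ∀ {x a w y ℓ₁ ℓ₂} → Seg x a ℓ₁ → Seg w y ℓ₂ →
      gaps A (reverse ℓ₁ ++ ℓ₂) ≡ gaps A ℓ₁ + gap (A x w) + gaps A ℓ₂
    gaps-reverseˡ {x} {w = w} {ℓ₂ = ℓ₂} s₁ s₂ =
      trans (adjSum-++ _ (Seg-reverse s₁) s₂)
            (cong (λ z → z + gap (A x w) + gaps A ℓ₂) (adjSum-reverse _ gap-sym s₁))

    gaps-reverseʳ : ∀ {x a w y ℓ₁ ℓ₂} → Seg x a ℓ₁ → Seg w y ℓ₂ →
      gaps A (ℓ₁ ++ reverse ℓ₂) ≡ gaps A ℓ₁ + gap (A a y) + gaps A ℓ₂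
    gaps-reverseʳ {a = a} {y = y} {ℓ₁} s₁ s₂ =
      trans (adjSum-++ _ s₁ (Seg-reverse s₂))
            (cong (gaps A ℓ₁ + gap (A a y) +_) (adjSum-reverse _ gap-sym s₂))

    -- Rotate the ordering cyclically so that one of its gaps becomes the closing pair.
    optimal-open : ∀ {c} → minDeficit A ≡ suc c →
      ∃₂ λ x y → ∃ λ ℓ → Seg x y ℓ × Ordering ℓ × gaps A ℓ ≤ c
    optimal-open {c} min with minDeficit-attained A
    ... | [] , o , _ with () ← subst (_≤ 0) min (minDeficit-least A ([] , o , z≤n))
    ... | x ∷ xs , o , d≤ with A (lastOf x xs) x in closing
    ...   | false = x , lastOf x xs , x ∷ xs , Seg-lastOf x xs , o , +-cancelʳ-≤ 1 _ c
                      (subst (gaps A (x ∷ xs) + 1 ≤_) (trans min (sym (+-comm c 1))) d≤)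
    ...   | true with adjSum-positive _ (Seg-lastOf x xs) 1≤gaps
      where
      -- The closing pair is an edge here, so the positive deficit must lie inside the list.
      1≤gaps : 1 ≤ gaps A (x ∷ xs)
      1≤gaps = ≤-trans (s≤s z≤n) (subst (_≤ gaps A (x ∷ xs)) min (minDeficit-least A
        (x ∷ xs , o , ≤-reflexive (trans (cong (λ b → gaps A (x ∷ xs) + gap b) closing) (+-identityʳ _)))))
    ...     | a , w , ℓ₁ , ℓ₂ , s₁ , s₂ , eq , 1≤gap =
      w , a , ℓ₂ ++ ℓ₁ , Seg-++ s₂ s₁ , ↭-trans (++-comm ℓ₂ ℓ₁) (subst Ordering eq o) , +-cancelʳ-≤ 1 _ c (begin
        gaps A (ℓ₂ ++ ℓ₁) + 1                                   ≡⟨ cong (_+ 1) (adjSum-++ _ s₂ s₁) ⟩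
        gaps A ℓ₂ + gap (A (lastOf x xs) x) + gaps A ℓ₁ + 1     ≡⟨ cong (λ b → gaps A ℓ₂ + gap b + gaps A ℓ₁ + 1) closing ⟩
        gaps A ℓ₂ + 0 + gaps A ℓ₁ + 1                           ≤⟨ +-monoʳ-≤ _ 1≤gap ⟩
        gaps A ℓ₂ + 0 + gaps A ℓ₁ + gap (A a w)                 ≡⟨ regroup (gaps A ℓ₂) (gaps A ℓ₁) _ ⟩
        gaps A ℓ₁ + gap (A a w) + gaps A ℓ₂ + 0                 ≡⟨ cong (_+ 0) (adjSum-++ _ s₁ s₂) ⟨
        gaps A (ℓ₁ ++ ℓ₂) + 0                                   ≡⟨ cong (λ ℓ → gaps A ℓ + 0) eq ⟨
        gaps A (x ∷ xs) + 0                                     ≤⟨ d≤ ⟩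
        minDeficit A                                            ≡⟨ trans min (+-comm 1 c) ⟩
        c + 1                                                   ∎)
      where
      open ≤-Reasoning
      regroup : ∀ p q r → p + 0 + q + r ≡ q + r + p + 0
      regroup = solve-∀

    -- Reversing the part up to a junction `a w` replaces the pairs `a w` and `y x` by `x w` and
    -- `y a`. Optimality forbids a saving, so among "`x w` is an edge", "`y a` is an edge" and
    -- "`a w` is a gap" at most one holds. Summing over the n - 1 junctions gives deg x + deg y + c
    -- ≤ n - 1.
    degree-sum : ∀ {c x y ℓ} → minDeficit A ≡ suc c → Seg x y ℓ → Ordering ℓ → gaps A ℓ ≤ c →
                 deg A x + deg A y + suc c ≤ n
    degree-sum {c} {x} {y} {ℓ} min s o g≤c = begin
      deg A x + deg A y + suc c                      ≤⟨ +-monoʳ-≤ _ (s≤s c≤gaps) ⟩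
      deg A x + deg A y + suc (gaps A ℓ)             ≡⟨ cong₂ (λ p q → p + q + suc (gaps A ℓ)) degʳ degˡ ⟩
      p + q + suc (gaps A ℓ)                         ≡⟨ +-suc (p + q) _ ⟩
      suc (p + q + gaps A ℓ)                         ≡⟨ cong (λ z → suc (z + gaps A ℓ)) (adjSum-+ Fʳ Fˡ ℓ) ⟨
      suc (adjSum (λ u v → Fʳ u v + Fˡ u v) ℓ + gaps A ℓ)  ≡⟨ cong suc (adjSum-+ _ _ ℓ) ⟨
      suc (adjSum (λ u v → Fʳ u v + Fˡ u v + gap (A u v)) ℓ)
        ≤⟨ s≤s (adjSum-mono _ (λ _ _ → 1) s exchange) ⟩
      1 + adjSum (λ _ _ → 1) ℓ                       ≡⟨ adjSum-right (const 1) s ⟩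
      listSum (const 1) ℓ                            ≡⟨ listSum-1 ℓ ⟩
      length ℓ                                       ≡⟨ trans (↭-length o) (length-tabulate id) ⟩
      n                                              ∎
      where
      open ≤-Reasoning
      Fʳ Fˡ : Fin n → Fin n → ℕ
      Fʳ u v = edge (A x v)
      Fˡ u v = edge (A y u)
      p = adjSum Fʳ ℓ
      q = adjSum Fˡ ℓ
      listSum-1 : ∀ (ℓ : List (Fin n)) → listSum (const 1) ℓ ≡ length ℓ
      listSum-1 []      = refl
      listSum-1 (_ ∷ ℓ) = cong suc (listSum-1 ℓ)
      degʳ : deg A x ≡ p
      degʳ = trans (sym (listSum-ordering _ o)) (trans (sym (adjSum-right _ s)) (cong (λ b → edge b + p) (A-irrefl x)))
      degˡ : deg A y ≡ q
      degˡ = trans (sym (listSum-ordering _ o)) (trans (sym (adjSum-left _ s)) (cong (λ b → edge b + q) (A-irrefl y)))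
      c≤gaps : c ≤ gaps A ℓ
      c≤gaps = +-cancelʳ-≤ 1 c _ (begin
        c + 1                  ≡⟨ trans (+-comm c 1) (sym min) ⟩
        minDeficit A           ≤⟨ minDeficit-least A (ℓ , o , ≤-refl) ⟩
        deficit A ℓ            ≡⟨ deficit-Seg A s ⟩
        gaps A ℓ + gap (A y x) ≤⟨ +-monoʳ-≤ _ (gap≤1 (A y x)) ⟩
        gaps A ℓ + 1           ∎)
      bool : ∀ b b′ {g} → suc g ≤ gap b + gap b′ → edge b + edge b′ + g ≤ 1
      bool true  false h         = h
      bool false true  h         = h
      bool false false (s≤s h)   = h
      exchange : ∀ {a w ℓ₁ ℓ₂} → Seg x a ℓ₁ → Seg w y ℓ₂ → ℓ ≡ ℓ₁ ++ ℓ₂ → Fʳ a w + Fˡ a w + gap (A a w) ≤ 1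
      exchange {a} {w} {ℓ₁} {ℓ₂} s₁ s₂ refl = bool (A x w) (A y a) (+-cancelˡ-≤ (gaps A ℓ₁ + gaps A ℓ₂) _ _ (begin
        g₁ + g₂ + suc (gap (A a w))           ≡⟨ regroup₁ g₁ g₂ _ ⟩
        suc (g₁ + gap (A a w) + g₂)           ≡⟨ cong suc (adjSum-++ _ s₁ s₂) ⟨
        suc (gaps A ℓ)                        ≤⟨ s≤s g≤c ⟩
        suc c                                 ≡⟨ min ⟨
        minDeficit A                          ≤⟨ minDeficit-least A (_ , Ordering-reverseˡ ℓ₁ ℓ₂ o , ≤-refl) ⟩
        deficit A (reverse ℓ₁ ++ ℓ₂)          ≡⟨ deficit-Seg A (Seg-++ (Seg-reverse s₁) s₂) ⟩
        gaps A (reverse ℓ₁ ++ ℓ₂) + gap (A y a) ≡⟨ cong (_+ gap (A y a)) (gaps-reverseˡ s₁ s₂) ⟩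
        g₁ + gap (A x w) + g₂ + gap (A y a)   ≡⟨ regroup₂ g₁ _ g₂ _ ⟩
        g₁ + g₂ + (gap (A x w) + gap (A y a)) ∎))
        where
        g₁ = gaps A ℓ₁
        g₂ = gaps A ℓ₂
        regroup₁ : ∀ p q r → p + q + suc r ≡ suc (p + r + q)
        regroup₁ = solve-∀
        regroup₂ : ∀ p q r s → p + q + r + s ≡ p + r + (q + s)
        regroup₂ = solve-∀

    -- Every neighbour of the first vertex x yields a rotation with a new first
    -- vertex, after which every neighbour of the last vertex y yields a rotation
    -- with a new last vertex; neither creates a gap.
    rotations : ∀ {c x y ℓ} δ → (∀ v → δ ≤ deg A v) → Seg x y ℓ → Ordering ℓ → gaps A ℓ ≤ c →
      (F : Fin n → Fin n → ℕ) →
      (∀ {a b ℓ} → Seg a b ℓ → Ordering ℓ → gaps A ℓ ≤ c → 1 ≤ F a b) →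
      δ * δ ≤ sum (λ a → sum (F a))
    rotations {c} {x} {y} {ℓ} δ δ≤deg s o g≤c F F-good = begin
      δ * δ                                        ≤⟨ *-monoˡ-≤ δ (δ≤deg x) ⟩
      deg A x * δ                                  ≡⟨ *-distribʳ-sum δ (λ v → edge (A x v)) ⟩
      sum (λ v → edge (A x v) * δ)                 ≡⟨ listSum-ordering _ o ⟨
      listSum (λ v → edge (A x v) * δ) ℓ           ≡⟨ adjSum-right _ s ⟨
      edge (A x x) * δ + adjSum (λ _ v → edge (A x v) * δ) ℓ
        ≡⟨ cong (λ b → edge b * δ + adjSum (λ _ v → edge (A x v) * δ) ℓ) (A-irrefl x) ⟩
      -- A neighbour w of x is charged to its predecessor a, which becomes first when the part
      -- before w is reversed. Distinct neighbours have distinct predecessors, so no row `F a` is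
      -- used twice.
      adjSum (λ _ v → edge (A x v) * δ) ℓ          ≤⟨ adjSum-mono _ _ s first ⟩
      adjSum (λ u _ → sum (F u)) ℓ                 ≤⟨ m≤n+m _ _ ⟩
      sum (F y) + adjSum (λ u _ → sum (F u)) ℓ     ≡⟨ adjSum-left _ s ⟩
      listSum (λ u → sum (F u)) ℓ                  ≡⟨ listSum-ordering _ o ⟩
      sum (λ a → sum (F a))                        ∎
      where
      open ≤-Reasoning
      second : ∀ {a ℓ} → Seg a y ℓ → Ordering ℓ → gaps A ℓ ≤ c → δ ≤ sum (F a)
      second {a} {ℓ} s o g≤c = begin
        δ                                          ≤⟨ δ≤deg y ⟩
        deg A y                                    ≡⟨ listSum-ordering _ o ⟨
        listSum (λ u → edge (A y u)) ℓ             ≡⟨ adjSum-left _ s ⟨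
        edge (A y y) + adjSum (λ u _ → edge (A y u)) ℓ
          ≡⟨ cong (λ b → edge b + adjSum (λ u _ → edge (A y u)) ℓ) (A-irrefl y) ⟩
        -- Dually, a neighbour u of y is charged to its successor b, which becomes last, while a
        -- stays first.
        adjSum (λ u _ → edge (A y u)) ℓ            ≤⟨ adjSum-mono _ _ s step ⟩
        adjSum (λ _ v → F a v) ℓ                   ≤⟨ m≤n+m _ _ ⟩
        F a a + adjSum (λ _ v → F a v) ℓ           ≡⟨ adjSum-right (F a) s ⟩
        listSum (F a) ℓ                            ≡⟨ listSum-ordering (F a) o ⟩
        sum (F a)                                  ∎
        where
        step : ∀ {u b ℓ₁ ℓ₂} → Seg a u ℓ₁ → Seg b y ℓ₂ → ℓ ≡ ℓ₁ ++ ℓ₂ → edge (A y u) ≤ F a b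
        step {u} {b} {ℓ₁} {ℓ₂} s₁ s₂ refl with A y u in adj
        ... | false = z≤n
        ... | true  = F-good (Seg-++ s₁ (Seg-reverse s₂)) (Ordering-reverseʳ ℓ₁ ℓ₂ o) (begin
          gaps A (ℓ₁ ++ reverse ℓ₂)                  ≡⟨ gaps-reverseʳ s₁ s₂ ⟩
          gaps A ℓ₁ + gap (A u y) + gaps A ℓ₂        ≡⟨ cong (λ b → gaps A ℓ₁ + gap b + gaps A ℓ₂) (trans (A-sym u y) adj) ⟩
          gaps A ℓ₁ + 0 + gaps A ℓ₂                  ≤⟨ +-monoˡ-≤ _ (+-monoʳ-≤ (gaps A ℓ₁) z≤n) ⟩
          gaps A ℓ₁ + gap (A u b) + gaps A ℓ₂        ≡⟨ adjSum-++ _ s₁ s₂ ⟨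
          gaps A (ℓ₁ ++ ℓ₂)                          ≤⟨ g≤c ⟩
          c                                          ∎)
      first : ∀ {a w ℓ₁ ℓ₂} → Seg x a ℓ₁ → Seg w y ℓ₂ → ℓ ≡ ℓ₁ ++ ℓ₂ → edge (A x w) * δ ≤ sum (F a)
      first {a} {w} {ℓ₁} {ℓ₂} s₁ s₂ refl with A x w in adj
      ... | false = z≤n
      ... | true  = ≤-trans (≤-reflexive (+-identityʳ δ))
        (second (Seg-++ (Seg-reverse s₁) s₂) (Ordering-reverseˡ ℓ₁ ℓ₂ o) (begin
          gaps A (reverse ℓ₁ ++ ℓ₂)                  ≡⟨ gaps-reverseˡ s₁ s₂ ⟩
          gaps A ℓ₁ + gap (A x w) + gaps A ℓ₂        ≡⟨ cong (λ b → gaps A ℓ₁ + gap b + gaps A ℓ₂) adj ⟩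
          gaps A ℓ₁ + 0 + gaps A ℓ₂                  ≤⟨ +-monoˡ-≤ _ (+-monoʳ-≤ (gaps A ℓ₁) z≤n) ⟩
          gaps A ℓ₁ + gap (A a w) + gaps A ℓ₂        ≡⟨ adjSum-++ _ s₁ s₂ ⟨
          gaps A (ℓ₁ ++ ℓ₂)                          ≤⟨ g≤c ⟩
          c                                          ∎))

-- The random process

sumExtensions-mono : ∀ {N} (f g : Vec Bool N → ℕ) S →
  (∀ e → f (S [ e ]≔ true) ≤ g (S [ e ]≔ true)) → sumExtensions f S ≤ sumExtensions g S
sumExtensions-mono f g S f≤g = sum-mono cell
  where
  cell : ∀ e → (if lookup S e then 0 else f (S [ e ]≔ true)) ≤ (if lookup S e then 0 else g (S [ e ]≔ true))
  cell e with lookup S e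
  ... | true  = z≤n
  ... | false = f≤g e

sumExtensions-+ : ∀ {N} (f g : Vec Bool N → ℕ) S →
  sumExtensions (λ T → f T + g T) S ≡ sumExtensions f S + sumExtensions g S
sumExtensions-+ {N} f g S = trans (sum-cong-≗ {N} cell) (∑-distrib-+ {N} _ _)
  where
  cell : ∀ e → (if lookup S e then 0 else f (S [ e ]≔ true) + g (S [ e ]≔ true))
             ≡ (if lookup S e then 0 else f (S [ e ]≔ true)) + (if lookup S e then 0 else g (S [ e ]≔ true))
  cell e with lookup S e
  ... | true  = refl
  ... | false = refl

sumExtensions-* : ∀ {N} (f : Vec Bool N → ℕ) c S →
  sumExtensions (λ T → f T * c) S ≡ sumExtensions f S * c
sumExtensions-* {N} f c S = trans (sum-cong-≗ {N} cell) (sym (*-distribʳ-sum {N} c _))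
  where
  cell : ∀ e → (if lookup S e then 0 else f (S [ e ]≔ true) * c)
             ≡ (if lookup S e then 0 else f (S [ e ]≔ true)) * c
  cell e with lookup S e
  ... | true  = refl
  ... | false = refl

-- tail G H t d / (G + H)^t is the probability that t independent trials, each
-- successful with probability G / (G + H), have fewer than d successes.
tail : ℕ → ℕ → ℕ → ℕ → ℕ
tail G H zero    zero    = 0
tail G H zero    (suc d) = 1
tail G H (suc t) zero    = 0
tail G H (suc t) (suc d) = G * tail G H t d + H * tail G H t (suc d)

tail-0 : ∀ G H t → tail G H t 0 ≡ 0
tail-0 G H zero    = refl
tail-0 G H (suc t) = refl

tail-suc : ∀ G H t d → tail G H t d ≤ tail G H t (suc d)
tail-suc G H zero    zero    = z≤n
tail-suc G H zero    (suc d) = ≤-refl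
tail-suc G H (suc t) zero    = z≤n
tail-suc G H (suc t) (suc d) =
  +-mono-≤ (*-monoʳ-≤ G (tail-suc G H t d)) (*-monoʳ-≤ H (tail-suc G H t (suc d)))

tail-mono : ∀ G H t {d d′} → d ≤ d′ → tail G H t d ≤ tail G H t d′
tail-mono G H t {d} {zero}  z≤n = ≤-refl
tail-mono G H t {d} {suc d′} d≤ with d ≤? d′
... | yes p = ≤-trans (tail-mono G H t p) (tail-suc G H t d′)
... | no ¬p = ≤-reflexive (cong (tail G H t) (≤-antisym d≤ (≰⇒> ¬p)))

module _ where

  open import Data.Integer using (+_)

  -- The right-hand side, a second moment, satisfies the recurrence of tail with
  -- equality, and for t = 0 < d it is at least s².
  tail-chebyshev-ℤ : ∀ G H s t d →
    (+ s ℤ.* + s) ℤ.* + tail G H t d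
      ℤ.≤ + ((G + H) ^ t) ℤ.* ((+ d ℤ.* + (G + H) ℤ.+ + s ℤ.- + G ℤ.* + t) ℤ.* (+ d ℤ.* + (G + H) ℤ.+ + s ℤ.- + G ℤ.* + t)
                                ℤ.+ + G ℤ.* + H ℤ.* + t)
  tail-chebyshev-ℤ G H s t d = bound t d
    where
    open ℤₚ.≤-Reasoning
    -- For S successes in t trials, `X t d` is the mean and GHt the variance of (G + H)(d - S) + s;
    -- on the event S < d this variable is at least s.
    X : ℕ → ℕ → ℤ
    X t d = + d ℤ.* + (G + H) ℤ.+ + s ℤ.- + G ℤ.* + t
    Q : ℕ → ℕ → ℤ
    Q t d = X t d ℤ.* X t d ℤ.+ + G ℤ.* + H ℤ.* + t
    square≥0 : ∀ i → 0ℤ ℤ.≤ i ℤ.* i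
    square≥0 (+ n)      = subst (0ℤ ℤ.≤_) (ℤₚ.pos-* n n) (ℤ.+≤+ z≤n)
    square≥0 (ℤ.-[1+ n ]) = ℤ.+≤+ z≤n
    Q≥0 : ∀ t d → 0ℤ ℤ.≤ Q t d
    Q≥0 t d = ℤₚ.+-mono-≤ (square≥0 (X t d))
      (subst (0ℤ ℤ.≤_) (trans (ℤₚ.pos-* (G * H) t) (cong (ℤ._* + t) (ℤₚ.pos-* G H))) (ℤ.+≤+ z≤n))
    PQ≥0 : ∀ t d → 0ℤ ℤ.≤ + ((G + H) ^ t) ℤ.* Q t d
    PQ≥0 t d = ℤₚ.≤-trans (ℤₚ.≤-reflexive (sym (ℤₚ.*-zeroʳ (+ ((G + H) ^ t))))) (ℤₚ.*-monoˡ-≤-nonNeg (+ ((G + H) ^ t)) (Q≥0 t d))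
    recurrence : ∀ g h d s t P →
      g ℤ.* (P ℤ.* ((d ℤ.* (g ℤ.+ h) ℤ.+ s ℤ.- g ℤ.* t) ℤ.* (d ℤ.* (g ℤ.+ h) ℤ.+ s ℤ.- g ℤ.* t) ℤ.+ g ℤ.* h ℤ.* t))
      ℤ.+ h ℤ.* (P ℤ.* (((+ 1 ℤ.+ d) ℤ.* (g ℤ.+ h) ℤ.+ s ℤ.- g ℤ.* t) ℤ.* ((+ 1 ℤ.+ d) ℤ.* (g ℤ.+ h) ℤ.+ s ℤ.- g ℤ.* t) ℤ.+ g ℤ.* h ℤ.* t))
      ≡ ((g ℤ.+ h) ℤ.* P) ℤ.* (((+ 1 ℤ.+ d) ℤ.* (g ℤ.+ h) ℤ.+ s ℤ.- g ℤ.* (+ 1 ℤ.+ t)) ℤ.* ((+ 1 ℤ.+ d) ℤ.* (g ℤ.+ h) ℤ.+ s ℤ.- g ℤ.* (+ 1 ℤ.+ t)) ℤ.+ g ℤ.* h ℤ.* (+ 1 ℤ.+ t))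
    recurrence = ℤSolver.solve-∀
    expand : ∀ g h s u v → s ℤ.* s ℤ.* (g ℤ.* u ℤ.+ h ℤ.* v) ≡ g ℤ.* (s ℤ.* s ℤ.* u) ℤ.+ h ℤ.* (s ℤ.* s ℤ.* v)
    expand = ℤSolver.solve-∀
    bound : ∀ t d → (+ s ℤ.* + s) ℤ.* + tail G H t d ℤ.≤ + ((G + H) ^ t) ℤ.* Q t d
    bound zero zero = ℤₚ.≤-trans (ℤₚ.≤-reflexive (ℤₚ.*-zeroʳ (+ s ℤ.* + s))) (PQ≥0 0 0)
    bound zero (suc d) = begin
      + s ℤ.* + s ℤ.* + 1                       ≡⟨ ℤₚ.*-identityʳ _ ⟩
      + s ℤ.* + s                               ≡⟨ ℤₚ.pos-* s s ⟨
      + (s * s)                                 ≤⟨ ℤ.+≤+ (*-mono-≤ {s} {b} {s} {b} (m≤n+m s _) (m≤n+m s _)) ⟩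
      + (b * b)                                 ≡⟨ ℤₚ.pos-* b b ⟩
      + b ℤ.* + b                               ≡⟨ cong (λ z → z ℤ.* z) (cong (ℤ._+ + s) (ℤₚ.pos-* (suc d) (G + H))) ⟩
      Y ℤ.* Y                                   ≡⟨ collapse Y (+ G) (+ H) ⟩
      + 1 ℤ.* Q 0 (suc d)                       ∎
      where
      b = suc d * (G + H) + s
      Y = + suc d ℤ.* + (G + H) ℤ.+ + s
      collapse : ∀ Y g h → Y ℤ.* Y ≡ + 1 ℤ.* ((Y ℤ.- g ℤ.* + 0) ℤ.* (Y ℤ.- g ℤ.* + 0) ℤ.+ g ℤ.* h ℤ.* + 0)
      collapse = ℤSolver.solve-∀
    bound (suc t) zero = ℤₚ.≤-trans (ℤₚ.≤-reflexive (ℤₚ.*-zeroʳ (+ s ℤ.* + s))) (PQ≥0 (suc t) 0)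
    bound (suc t) (suc d) = begin
      + s ℤ.* + s ℤ.* + (G * u + H * v)                                ≡⟨ cong (+ s ℤ.* + s ℤ.*_) (cong₂ ℤ._+_ (ℤₚ.pos-* G u) (ℤₚ.pos-* H v)) ⟩
      + s ℤ.* + s ℤ.* (+ G ℤ.* + u ℤ.+ + H ℤ.* + v)                    ≡⟨ expand (+ G) (+ H) (+ s) (+ u) (+ v) ⟩
      + G ℤ.* (+ s ℤ.* + s ℤ.* + u) ℤ.+ + H ℤ.* (+ s ℤ.* + s ℤ.* + v)  ≤⟨ ℤₚ.+-mono-≤ (ℤₚ.*-monoˡ-≤-nonNeg (+ G) (bound t d)) (ℤₚ.*-monoˡ-≤-nonNeg (+ H) (bound t (suc d))) ⟩
      + G ℤ.* (P ℤ.* Q t d) ℤ.+ + H ℤ.* (P ℤ.* Q t (suc d))            ≡⟨ recurrence (+ G) (+ H) (+ d) (+ s) (+ t) P ⟩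
      (+ (G + H) ℤ.* P) ℤ.* Q (suc t) (suc d)                          ≡⟨ cong (ℤ._* Q (suc t) (suc d)) (ℤₚ.pos-* (G + H) _) ⟨
      + ((G + H) ^ suc t) ℤ.* Q (suc t) (suc d)                        ∎
      where
      u = tail G H t d
      v = tail G H t (suc d)
      P = + ((G + H) ^ t)

  -- The hypothesis places the mean at d + s/(G + H), which makes the squared mean term vanish and
  -- leaves only the variance GHt.
  tail-chebyshev : ∀ G H s t d → G * t ≡ d * (G + H) + s →
    s * s * tail G H t d ≤ (G + H) ^ t * (G * H * t)
  tail-chebyshev G H s t d eq = ℤₚ.drop‿+≤+ (begin
    + (s * s * tail G H t d)                 ≡⟨ ℤₚ.pos-* (s * s) _ ⟩
    + (s * s) ℤ.* + tail G H t d             ≡⟨ cong (ℤ._* + tail G H t d) (ℤₚ.pos-* s s) ⟩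
    + s ℤ.* + s ℤ.* + tail G H t d           ≤⟨ tail-chebyshev-ℤ G H s t d ⟩
    P ℤ.* (X ℤ.* X ℤ.+ + G ℤ.* + H ℤ.* + t)  ≡⟨ cong (λ z → P ℤ.* (z ℤ.* z ℤ.+ + G ℤ.* + H ℤ.* + t)) X≡0 ⟩
    P ℤ.* (0ℤ ℤ.+ + G ℤ.* + H ℤ.* + t)       ≡⟨ cong (P ℤ.*_) (trans (ℤₚ.+-identityˡ _) (cong (ℤ._* + t) (sym (ℤₚ.pos-* G H)))) ⟩
    P ℤ.* (+ (G * H) ℤ.* + t)                ≡⟨ cong (P ℤ.*_) (ℤₚ.pos-* (G * H) t) ⟨
    P ℤ.* + (G * H * t)                      ≡⟨ ℤₚ.pos-* ((G + H) ^ t) _ ⟨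
    + ((G + H) ^ t * (G * H * t))            ∎)
    where
    open ℤₚ.≤-Reasoning
    P = + ((G + H) ^ t)
    X = + d ℤ.* + (G + H) ℤ.+ + s ℤ.- + G ℤ.* + t
    X≡0 : X ≡ 0ℤ
    X≡0 = ℤₚ.i≡j⇒i-j≡0 (trans (cong (ℤ._+ + s) (sym (ℤₚ.pos-* d (G + H))))
            (trans (cong +_ (sym eq)) (ℤₚ.pos-* G t)))

-- The process in abstract form: `d` never rises, and while positive it falls for at least G/2 of
-- the free positions. Doubling keeps the success probability G/(2N) = G/(G + H) free of halves.
module _ {N : ℕ} (d : Vec Bool N → ℕ) (G H : ℕ) (G+H≡2N : G + H ≡ 2 * N)
  (d-antitone : ∀ S e → d (S [ e ]≔ true) ≤ d S)
  (d-drop : ∀ S {c} → d S ≡ suc c → G ≤ 2 * sumExtensions (λ T → indicator (d T ≤? c)) S) where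

  private
    -- Of r free positions, c have value at most p and the others at most p + q. The improving
    -- fraction c/r is at least G/(2N), since r ≤ N: drawing without replacement can only help.
    drop-arith : ∀ E c p q r → E + c * (p + q) ≤ r * (p + q) + c * p → G ≤ 2 * c → r ≤ N →
      2 * N * E ≤ r * (G * p + H * (p + q))
    drop-arith E c p q r h G≤ r≤ = +-cancelʳ-≤ (r * (G * q)) _ _ (begin
      2 * N * E + r * (G * q)        ≤⟨ +-monoʳ-≤ (2 * N * E) (*-mono-≤ r≤ (*-monoˡ-≤ q G≤)) ⟩
      2 * N * E + N * (2 * c * q)    ≡⟨ e₁ N E c q ⟩
      2 * N * (E + c * q)            ≤⟨ *-monoʳ-≤ (2 * N) (+-cancelʳ-≤ (c * p) _ _ (≤-trans (≤-reflexive (e₂ E c p q)) h)) ⟩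
      2 * N * (r * (p + q))          ≡⟨ cong (_* (r * (p + q))) G+H≡2N ⟨
      (G + H) * (r * (p + q))        ≡⟨ e₃ G H r p q ⟩
      r * (G * p + H * (p + q)) + r * (G * q) ∎)
      where
      open ≤-Reasoning
      e₁ : ∀ N E c q → 2 * N * E + N * (2 * c * q) ≡ 2 * N * (E + c * q)
      e₁ = solve-∀
      e₂ : ∀ E c p q → E + c * q + c * p ≡ E + c * (p + q)
      e₂ = solve-∀
      e₃ : ∀ G H r p q → (G + H) * (r * (p + q)) ≡ r * (G * p + H * (p + q)) + r * (G * q)
      e₃ = solve-∀

  -- One step of the domination: averaged over the free positions, the tail of t trials is at most
  -- the tail of t + 1 trials before the step.
  extension-bound : ∀ t {j} S → boolCount S ≡ j →
    2 * N * sumExtensions (tail G H t ∘ d) S ≤ (N ∸ j) * tail G H (suc t) (d S)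
  extension-bound t {j} S size with d S in dS
  ... | zero = begin
    2 * N * sumExtensions (tail G H t ∘ d) S        ≤⟨ *-monoʳ-≤ (2 * N) (sumExtensions-mono f (λ _ → 1 * 0) S (λ e →
                                                         ≤-trans (tail-mono G H t (subst (d (S [ e ]≔ true) ≤_) dS (d-antitone S e)))
                                                                 (≤-reflexive (tail-0 G H t)))) ⟩
    2 * N * sumExtensions (λ _ → 1 * 0) S           ≡⟨ cong (2 * N *_) (trans (sumExtensions-* (const 1) 0 S) (*-zeroʳ (sumExtensions (const 1) S))) ⟩
    2 * N * 0                                       ≡⟨ *-zeroʳ (2 * N) ⟩
    0                                               ≤⟨ z≤n ⟩
    (N ∸ j) * 0                                     ∎
    where
    open ≤-Reasoning
    f = tail G H t ∘ d
  ... | suc c = subst (λ v → 2 * N * sumExtensions f S ≤ (N ∸ j) * (G * p + H * v)) p+q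
                  (drop-arith (sumExtensions f S) cnt p q (N ∸ j) total (d-drop S dS) (m∸n≤m N j))
    where
    f = tail G H t ∘ d
    p = tail G H t c
    q = tail G H t (suc c) ∸ p
    p+q : p + q ≡ tail G H t (suc c)
    p+q = m+[n∸m]≡n (tail-suc G H t c)
    I : Vec Bool N → ℕ
    I T = indicator (d T ≤? c)
    cnt = sumExtensions I S
    cell : ∀ e → let T = S [ e ]≔ true in (dT≤c? : Dec (d T ≤ c)) →
           f T + indicator dT≤c? * (p + q) ≤ 1 * (p + q) + indicator dT≤c? * p
    cell e (yes dT≤c) = ≤-trans (+-monoˡ-≤ _ (tail-mono G H t dT≤c)) (≤-reflexive (swap p q))
      where
      swap : ∀ p q → p + 1 * (p + q) ≡ 1 * (p + q) + 1 * p
      swap = solve-∀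
    cell e (no _) = +-monoˡ-≤ 0 (≤-trans (tail-mono G H t (subst (d (S [ e ]≔ true) ≤_) dS (d-antitone S e)))
                                 (≤-reflexive (trans (sym p+q) (sym (*-identityˡ _)))))
    fI gI : Vec Bool N → ℕ
    fI T = f T + I T * (p + q)
    gI T = 1 * (p + q) + I T * p
    total : sumExtensions f S + cnt * (p + q) ≤ (N ∸ j) * (p + q) + cnt * p
    total = begin
      sumExtensions f S + cnt * (p + q)                          ≡⟨ cong (sumExtensions f S +_) (sumExtensions-* I (p + q) S) ⟨
      sumExtensions f S + sumExtensions (λ T → I T * (p + q)) S  ≡⟨ sumExtensions-+ f (λ T → I T * (p + q)) S ⟨
      sumExtensions (λ T → f T + I T * (p + q)) S                ≤⟨ sumExtensions-mono fI gI S (λ e → cell e (_ ≤? c)) ⟩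
      sumExtensions (λ T → 1 * (p + q) + I T * p) S              ≡⟨ sumExtensions-+ (λ _ → 1 * (p + q)) (λ T → I T * p) S ⟩
      sumExtensions (λ _ → 1 * (p + q)) S + sumExtensions (λ T → I T * p) S
        ≡⟨ cong₂ _+_ (trans (sumExtensions-* (const 1) (p + q) S) (cong (_* (p + q)) (sumExtensions-free S size)))
                     (sumExtensions-* I p S) ⟩
      (N ∸ j) * (p + q) + cnt * p                                ∎
      where open ≤-Reasoning

  -- The induction removes one random element and adds one trial, so it needs the claim for every
  -- number t of trials still to come.
  tail-average : ∀ j t → (2 * N) ^ j * sumSubsets N j (tail G H t ∘ d)
                           ≤ count N j * tail G H (j + t) (d (replicate N false))
  tail-average zero t = ≤-reflexive (trans (*-identityˡ _) (trans (sumSubsets-empty N _)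
    (sym (trans (cong (_* tail G H t (d (replicate N false))) (sumSubsets-empty N (const 1))) (*-identityˡ _)))))
  tail-average (suc j) t = *-cancelˡ-≤ (suc j) (begin
    suc j * ((2 * N) ^ suc j * A)                        ≡⟨ e₁ (suc j) (2 * N) ((2 * N) ^ j) A ⟩
    (2 * N) ^ j * (2 * N * (suc j * A))                  ≡⟨ cong (λ z → (2 * N) ^ j * (2 * N * z)) (sumSubsets-extensions N j _) ⟨
    (2 * N) ^ j * (2 * N * sumSubsets N j (sumExtensions (tail G H t ∘ d)))
      ≡⟨ cong ((2 * N) ^ j *_) (sumSubsets-* N j (2 * N) _) ⟨
    (2 * N) ^ j * sumSubsets N j (λ S → 2 * N * sumExtensions (tail G H t ∘ d) S)
      ≤⟨ *-monoʳ-≤ ((2 * N) ^ j) (sumSubsets-mono N j (extension-bound t)) ⟩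
    (2 * N) ^ j * sumSubsets N j (λ S → (N ∸ j) * tail G H (suc t) (d S))
      ≡⟨ cong ((2 * N) ^ j *_) (sumSubsets-* N j (N ∸ j) _) ⟩
    (2 * N) ^ j * ((N ∸ j) * sumSubsets N j (tail G H (suc t) ∘ d))
      ≡⟨ e₂ ((2 * N) ^ j) (N ∸ j) _ ⟩
    (N ∸ j) * ((2 * N) ^ j * sumSubsets N j (tail G H (suc t) ∘ d))
      ≤⟨ *-monoʳ-≤ (N ∸ j) (tail-average j (suc t)) ⟩
    (N ∸ j) * (count N j * tail G H (j + suc t) d₀)      ≡⟨ *-assoc (N ∸ j) _ _ ⟨
    (N ∸ j) * count N j * tail G H (j + suc t) d₀        ≡⟨ cong₂ _*_ (sym (count-suc N j)) (cong (λ k → tail G H k d₀) (+-suc j t)) ⟩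
    suc j * count N (suc j) * tail G H (suc j + t) d₀    ≡⟨ *-assoc (suc j) (count N (suc j)) _ ⟩
    suc j * (count N (suc j) * tail G H (suc j + t) d₀)  ∎)
    where
    open ≤-Reasoning
    A = sumSubsets N (suc j) (tail G H t ∘ d)
    d₀ = d (replicate N false)
    e₁ : ∀ a b c x → a * (b * c * x) ≡ c * (b * (a * x))
    e₁ = solve-∀
    e₂ : ∀ a b x → a * (b * x) ≡ b * (a * x)
    e₂ = solve-∀

  -- With no trials left, the tail is exactly the indicator of d ≥ 1, so `tail-average` at t = 0
  -- bounds the number of failures.
  positive-rare : ∀ m D s → d (replicate N false) ≤ D → .{{NonZero (2 * N)}} →
    G * m ≡ D * (2 * N) + s →
    sumSubsets N m (λ S → indicator (1 ≤? d S)) * (s * s) ≤ count N m * (G * (2 * N) * m)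
  positive-rare m D s d₀≤D eq = *-cancelˡ-≤ ((2 * N) ^ m) {{m^n≢0 (2 * N) m}} (begin
    (2 * N) ^ m * (F * (s * s))                        ≡⟨ *-assoc ((2 * N) ^ m) F _ ⟨
    (2 * N) ^ m * F * (s * s)                          ≡⟨ cong (λ z → (2 * N) ^ m * z * (s * s)) (sumSubsets-cong N m (λ S _ → indicator-tail (d S))) ⟩
    (2 * N) ^ m * sumSubsets N m (tail G H 0 ∘ d) * (s * s)
      ≤⟨ *-monoˡ-≤ (s * s) (tail-average m 0) ⟩
    count N m * tail G H (m + 0) (d _) * (s * s)       ≤⟨ *-monoˡ-≤ (s * s) (*-monoʳ-≤ (count N m) (tail-mono G H (m + 0) d₀≤D)) ⟩
    count N m * tail G H (m + 0) D * (s * s)           ≡⟨ cong (λ k → count N m * tail G H k D * (s * s)) (+-identityʳ m) ⟩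
    count N m * tail G H m D * (s * s)                 ≡⟨ e₁ (count N m) _ (s * s) ⟩
    count N m * (s * s * tail G H m D)                 ≤⟨ *-monoʳ-≤ (count N m) (tail-chebyshev G H s m D (subst (λ M → G * m ≡ D * M + s) (sym G+H≡2N) eq)) ⟩
    -- The variance GHm is relaxed to G(G + H)m, the form that `trials-suffice` controls.
    count N m * ((G + H) ^ m * (G * H * m))            ≤⟨ *-monoʳ-≤ (count N m) (*-monoʳ-≤ ((G + H) ^ m) (*-monoˡ-≤ m (*-monoʳ-≤ G (m≤n+m H G)))) ⟩
    count N m * ((G + H) ^ m * (G * (G + H) * m))      ≡⟨ cong (λ M → count N m * (M ^ m * (G * M * m))) G+H≡2N ⟩
    count N m * ((2 * N) ^ m * (G * (2 * N) * m))      ≡⟨ e₂ (count N m) ((2 * N) ^ m) _ ⟩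
    (2 * N) ^ m * (count N m * (G * (2 * N) * m))      ∎)
    where
    open ≤-Reasoning
    F = sumSubsets N m (λ S → indicator (1 ≤? d S))
    indicator-tail : ∀ k → indicator (1 ≤? k) ≡ tail G H 0 k
    indicator-tail zero    = refl
    indicator-tail (suc k) = refl
    e₁ : ∀ a b x → a * b * x ≡ a * (x * b)
    e₁ = solve-∀
    e₂ : ∀ a b x → a * (b * x) ≡ b * (a * x)
    e₂ = solve-∀

-- The perturbed graph as an instance of the process

edge≤1 : ∀ b → edge b ≤ 1
edge≤1 true  = ≤-refl
edge≤1 false = z≤n

sum≤n : ∀ {n} (f : Fin n → ℕ) → (∀ i → f i ≤ 1) → sum f ≤ n
sum≤n {zero}  f f≤1 = z≤n
sum≤n {suc n} f f≤1 = +-mono-≤ (f≤1 zero) (sum≤n (f ∘ suc) (f≤1 ∘ suc))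

sum<n : ∀ {n} (f : Fin n → ℕ) → (∀ i → f i ≤ 1) → ∀ v → f v ≡ 0 → suc (sum f) ≤ n
sum<n f f≤1 zero    fv rewrite fv = s≤s (sum≤n (f ∘ suc) (f≤1 ∘ suc))
sum<n {suc n} f f≤1 (suc v) fv =
  subst (_≤ suc n) (+-suc (f zero) _) (+-mono-≤ (f≤1 zero) (sum<n (f ∘ suc) (f≤1 ∘ suc) v fv))

count-complement : ∀ N j (d : Vec Bool N → ℕ) →
  sumSubsets N j (λ S → indicator (1 ≤? d S)) + sumSubsets N j (λ S → indicator (d S ≤? 0)) ≡ count N j
count-complement N j d =
  trans (sym (sumSubsets-+ N j _ _)) (sumSubsets-cong N j λ S _ → split (d S))
  where
  split : ∀ k → indicator (1 ≤? k) + indicator (k ≤? 0) ≡ 1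
  split zero    = refl
  split (suc k) = refl

module Perturbed {n : ℕ} (H : SimpleGraph n) where

  open Orderings {n}

  union : Vec Bool (pairs n) → Fin n → Fin n → Bool
  union S i j = entry (adj H) i j ∨ tri false (lookup S) i j

  entry-union : ∀ S i j → entry (adj H ∪ᴳ toMat n S) i j ≡ union S i j
  entry-union S i j =
    trans (entry-∪ (adj H) (toMat n S) i j) (cong (entry (adj H) i j ∨_) (entry-toMat n S i j))

  union-sym : ∀ S i j → union S i j ≡ union S j i
  union-sym S i j = cong₂ _∨_ (proj₁ (simple H) i j) (tri-sym false (lookup S) i j)

  union-irrefl : ∀ S i → union S i i ≡ false
  union-irrefl S i = cong₂ _∨_ (proj₂ (simple H) i) (tri-diag false (lookup S) i)

  union-adds : ∀ {S i j} e → (∀ {A : Set} (x : A) F → tri {n = n} x F i j ≡ F e) →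
               lookup S e ≡ true → union S i j ≡ true
  union-adds {S} {i} {j} e at Se =
    trans (cong (entry (adj H) i j ∨_) (trans (at false (lookup S)) Se)) (∨-zeroʳ _)

  union-extend : ∀ S e i j → union S i j ≡ true → union (S [ e ]≔ true) i j ≡ true
  union-extend S e i j h with i ≟ j
  ... | yes refl with () ← trans (sym h) (union-irrefl S i)
  ... | no i≢j with entry (adj H) i j | tri-index i j i≢j
  ...   | true  | _ = refl
  ...   | false | e′ , at = trans (at false _) (grow (trans (sym (at false (lookup S))) h))
    where
    grow : lookup S e′ ≡ true → lookup (S [ e ]≔ true) e′ ≡ true
    grow Se′ with e′ ≟ e
    ... | yes refl = lookup∘update e S true
    ... | no e′≢e  = trans (lookup∘update′ e′≢e S true) Se′

  degree-sum-edge : ∀ v → degree (adj H) v ≡ sum (λ w → edge (entry (adj H) v w))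
  degree-sum-edge v = boolCount-sum (lookup (adj H) v)

  degree≤deg : ∀ S v → degree (adj H) v ≤ deg (union S) v
  degree≤deg S v = ≤-trans (≤-reflexive (degree-sum-edge v)) (sum-mono λ w → edge-∨ (entry (adj H) v w) _)
    where
    edge-∨ : ∀ b b′ → edge b ≤ edge (b ∨ b′)
    edge-∨ true  b′ = ≤-refl
    edge-∨ false b′ = z≤n

  degree<n : ∀ v → suc (degree (adj H) v) ≤ n
  degree<n v = subst (λ k → suc k ≤ n) (sym (degree-sum-edge v))
    (sum<n _ (λ w → edge≤1 (entry (adj H) v w)) v (cong edge (proj₂ (simple H) v)))

  ordering-unique : ∀ {ℓ} → Ordering ℓ → Unique ℓ
  ordering-unique o =
    Permₚ.Unique-resp-↭ (setoid (Fin n)) (↭⇒↭ₛ (↭-sym o)) (Uniqueₚ.allFin⁺ n)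

  ordering-length : ∀ {ℓ} → Ordering ℓ → length ℓ ≡ n
  ordering-length o = trans (↭-length o) (length-tabulate id)

  gap≡0 : ∀ S i j → gap (union S i j) ≡ 0 → Adj (adj H ∪ᴳ toMat n S) i j
  gap≡0 S i j h with union S i j in eq
  ... | true = trans (entry-union S i j) eq

  no-gaps⇒path : ∀ S x xs → gaps (union S) (x ∷ xs) ≡ 0 → PathFrom (adj H ∪ᴳ toMat n S) x xs
  no-gaps⇒path S x []       g≡0 = tt
  no-gaps⇒path S x (y ∷ ys) g≡0 =
    gap≡0 S x y (m+n≡0⇒m≡0 _ g≡0) , no-gaps⇒path S y ys (m+n≡0⇒n≡0 (gap (union S x y)) g≡0)

  d : Vec Bool (pairs n) → ℕ
  d S = minDeficit (union S)

  d≡0⇒Hamiltonian : 3 ≤ n → ∀ S → d S ≤ 0 → Hamiltonian (adj H ∪ᴳ toMat n S)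
  d≡0⇒Hamiltonian 3≤n S d≤0 with minDeficit-attained (union S)
  ... | [] , o , _ with refl ← ordering-length o with () ← 3≤n
  ... | x ∷ xs , o , def≤ =
    x , xs , ordering-unique o , ordering-length o , 3≤n
    , no-gaps⇒path S x xs (m+n≡0⇒m≡0 _ def≡0)
    , gap≡0 S _ x (m+n≡0⇒n≡0 (gaps (union S) (x ∷ xs)) def≡0)
    where
    def≡0 : deficit (union S) (x ∷ xs) ≡ 0
    def≡0 = n≤0⇒n≡0 (≤-trans def≤ d≤0)

  module _ (3≤n : 3 ≤ n) (δ : ℕ) (δ≤degree : ∀ v → δ ≤ degree (adj H) v) where

    δ≤deg : ∀ S v → δ ≤ deg (union S) v
    δ≤deg S v = ≤-trans (δ≤degree v) (degree≤deg S v)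

    d-start : d (replicate _ false) ≤ n ∸ 2 * δ
    d-start with d (replicate _ false) in eq
    ... | zero  = z≤n
    ... | suc c with optimal-open (union (replicate _ false)) (union-sym (replicate _ false)) (union-irrefl (replicate _ false)) eq
    ...   | x , y , ℓ , s , o , g = m+n≤o⇒m≤o∸n (suc c) (begin
      suc c + 2 * δ                        ≡⟨ regroup (suc c) δ ⟩
      δ + δ + suc c                        ≤⟨ +-monoˡ-≤ (suc c) (+-mono-≤ (δ≤deg ∅ x) (δ≤deg ∅ y)) ⟩
      deg (union ∅) x + deg (union ∅) y + suc c
        ≤⟨ degree-sum (union ∅) (union-sym ∅) (union-irrefl ∅) eq s o g ⟩
      n                                    ∎)
      where
      open ≤-Reasoning
      ∅ = replicate (pairs n) false
      regroup : ∀ c δ → c + 2 * δ ≡ δ + δ + c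
      regroup = solve-∀

    -- Each pair is weighted by whether it is a new edge that lowers `d`. `rotations` bounds the
    -- total weight over ordered pairs from below, and `sum-tri` converts it to edges.
    d-drops : ∀ S {c} → d S ≡ suc c →
              δ * δ ≤ 2 * sumExtensions (λ T → indicator (d T ≤? c)) S
    d-drops S {c} eq with optimal-open (union S) (union-sym S) (union-irrefl S) eq
    ... | x , y , ℓ , s , o , g≤c = subst (δ * δ ≤_) (sum-tri n good)
      (rotations (union S) (union-sym S) (union-irrefl S) δ (δ≤deg S) s o g≤c (tri 0 good) tri-good)
      where
      good : Fin (pairs n) → ℕ
      good e = if lookup S e then 0 else indicator (d (S [ e ]≔ true) ≤? c)
      indicator-yes : ∀ {P : Set} (P? : Dec P) → P → 1 ≤ indicator P?
      indicator-yes (yes _) p = ≤-refl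
      indicator-yes (no ¬p) p = contradiction p ¬p
      tri-good : ∀ {a b ℓ} → Seg a b ℓ → Ordering ℓ → gaps (union S) ℓ ≤ c → 1 ≤ tri 0 good a b
      tri-good {a} {b} {ℓ} s o g≤c with tri-index a b (Seg-ends-distinct s (ordering-unique o)
                                   (subst (2 ≤_) (sym (ordering-length o)) (≤-trans (n≤1+n 2) 3≤n)))
      ... | e , at = subst (1 ≤_) (sym (at 0 good)) good-e
        where
        open ≤-Reasoning
        improves : ∀ T → (∀ i j → union S i j ≡ true → union T i j ≡ true) → lookup T e ≡ true → d T ≤ c
        improves T S⊆T Te = minDeficit-least (union T) (ℓ , o , (begin
          deficit (union T) ℓ                    ≡⟨ deficit-Seg (union T) s ⟩
          gaps (union T) ℓ + gap (union T b a)   ≡⟨ cong (λ z → gaps (union T) ℓ + gap z) (trans (union-sym T b a) (union-adds {T} e at Te)) ⟩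
          gaps (union T) ℓ + 0                   ≡⟨ +-identityʳ _ ⟩
          gaps (union T) ℓ                       ≤⟨ gaps-antitone S⊆T ℓ ⟩
          gaps (union S) ℓ                       ≤⟨ g≤c ⟩
          c                                      ∎))
        good-e : 1 ≤ good e
        good-e with lookup S e in Se
        -- Were the closing pair already present, the ordering would have deficit at most c, against
        -- `d S ≡ suc c`.
        ... | true  = contradiction (subst (_≤ c) eq (improves S (λ _ _ h → h) Se)) (n≮n c)
        ... | false = indicator-yes (d (S [ e ]≔ true) ≤? c)
                        (improves (S [ e ]≔ true) (union-extend S e) (lookup∘update e S true))

    -- Needed for H = n(n-1) - δ² to complement G = δ². It holds because a simple graph has degrees
    -- at most n - 1.
    δ²≤2pairs : δ * δ ≤ 2 * pairs n
    δ²≤2pairs = +-cancelʳ-≤ n _ _ (subst (δ * δ + n ≤_) (sym (2*pairs n)) (square n δ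
      (≤-trans (s≤s (δ≤degree v₀)) (degree<n v₀))))
      where
      v₀ : Fin n
      v₀ = fromℕ< (≤-trans (s≤s z≤n) 3≤n)
      square : ∀ n δ → suc δ ≤ n → δ * δ + n ≤ n * n
      square (suc k) δ (s≤s δ≤k) = ≤-trans (+-monoˡ-≤ (suc k) (*-mono-≤ δ≤k δ≤k))
        (subst (k * k + suc k ≤_) (sym (expand k)) (m≤m+n _ k))
        where
        expand : ∀ k → suc k * suc k ≡ k * k + suc k + k
        expand = solve-∀

    -- With Z = δ²Mm the Chebyshev count reads F s² ≤ cZ for the number F of failures. Together with
    -- kZ ≤ s² this gives kF ≤ c once the positive factor Z is cancelled; the remaining subsets have
    -- d = 0.
    hamiltonian-likely : ∀ m k s → δ * δ * m ≡ (n ∸ 2 * δ) * (2 * pairs n) + s → 1 ≤ s →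
      k * (δ * δ * (2 * pairs n) * m) ≤ s * s → ProbHamAtLeast H m k
    hamiltonian-likely m k s eq 1≤s ks with listSubsets (pairs n) m (λ S → d S ≤? 0)
    ... | L , unique , all , len =
      List.map (toMat n) L
      , Uniqueₚ.map⁺ (toMat-injective n) unique
      , Allₚ.map⁺ (All.map (λ {S} (size , d≤0) →
          toMat-simple n S , trans (edgeCount-toMat n S) size , d≡0⇒Hamiltonian 3≤n S d≤0) all)
      , subst (λ l → (k ∸ 1) * ((n C 2) C m) ≤ k * l) (sym (length-map (toMat n) L))
          (subst (λ c → (k ∸ 1) * c ≤ k * length L) (trans (count-C (pairs n) m) (cong (_C m) (pairs-C n))) mostly)
      where
      open ≤-Reasoning
      N = pairs n
      M = 2 * N
      Z = δ * δ * M * m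
      c = count N m
      F = sumSubsets N m (λ S → indicator (1 ≤? d S))
      instance
        M≢0 : NonZero M
        M≢0 = >-nonZero (1≤2*pairs 3≤n)
      Z>0 : 1 ≤ Z
      Z>0 = begin
        1                                    ≤⟨ *-mono-≤ 1≤s (1≤2*pairs 3≤n) ⟩
        s * M                                ≤⟨ *-monoˡ-≤ M (m≤n+m s ((n ∸ 2 * δ) * M)) ⟩
        ((n ∸ 2 * δ) * M + s) * M            ≡⟨ cong (_* M) eq ⟨
        δ * δ * m * M                        ≡⟨ regroup (δ * δ) m M ⟩
        Z                                    ∎
        where
        regroup : ∀ a b c → a * b * c ≡ a * c * b
        regroup = solve-∀
      rare : k * F ≤ c
      rare = *-cancelʳ-≤ (k * F) c Z {{>-nonZero Z>0}} (begin
        k * F * Z      ≡⟨ regroup k F Z ⟩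
        F * (k * Z)    ≤⟨ *-monoʳ-≤ F ks ⟩
        F * (s * s)    ≤⟨ positive-rare d (δ * δ) (M ∸ δ * δ) (m+[n∸m]≡n δ²≤2pairs)
                            (λ S e → minDeficit-antitone (union-extend S e)) d-drops m (n ∸ 2 * δ) s d-start eq ⟩
        c * Z          ∎)
        where
        regroup : ∀ a b c → a * b * c ≡ b * (a * c)
        regroup = solve-∀
      mostly : (k ∸ 1) * c ≤ k * length L
      mostly = begin
        (k ∸ 1) * c                     ≡⟨ *-distribʳ-∸ c k 1 ⟩
        k * c ∸ 1 * c                   ≡⟨ cong₂ _∸_ (cong (k *_) (sym (count-complement N m d))) (*-identityˡ c) ⟩
        k * (F + _) ∸ c                 ≡⟨ cong (_∸ c) (*-distribˡ-+ k F _) ⟩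
        k * F + k * _ ∸ c               ≤⟨ ∸-monoˡ-≤ c (+-monoˡ-≤ _ rare) ⟩
        c + k * _ ∸ c                   ≡⟨ m+n∸m≡n c _ ⟩
        k * _                           ≡⟨ cong (k *_) len ⟨
        k * length L                    ∎

-- Choice of margins and the asymptotic statement

open RationalArithmetic

-- The minimum is attained at a vertex, through which the degree hypothesis on H passes to δ.
minDegree : ∀ {n} (A : Mat n) → Fin n →
  ∃ λ δ → (∃ λ v → degree A v ≡ δ) × (∀ v → δ ≤ degree A v)
minDegree A v₀ with least (λ c → any? (λ v → degree A v ≤? c)) (degree A v₀) (v₀ , ≤-refl)
... | δ , (v , deg≤δ) , lower = δ , (v , ≤-antisym deg≤δ (lower _ (v , ≤-refl))) , λ u → lower _ (u , ≤-refl)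

module _ {n : ℕ} (H : SimpleGraph n) (η : ℚ) (m k : ℕ) (3≤n : 3 ≤ n) (1≤k : 1 ≤ k)
  (H-degree : ∀ v → ℤ.+ n ℚ./ 2 ℚ.- η ℚ.≤ ι (degree (adj H) v))
  (½≤η : ½ ℚ.≤ η) (η≤n/64 : η ℚ.≤ ℤ.+ n ℚ./ 64) where

  private
    0≤n : 0ℚ ℚ.≤ ι n
    0≤n = 0≤ι n

    1≤κ : 1ℚ ℚ.≤ ι k
    1≤κ = ι-mono {1} {k} 1≤k

    η≤ : η ℚ.≤ ι n ℚ.* 1/64
    η≤ = subst (η ℚ.≤_) (/≡*1/ n 63) η≤n/64

  -- Common core of both parts for a fixed n: `w` is the margin of the mean number of successes over
  -- 2η.
  hamiltonian-whp : ∀ w → 2ℚ ℚ.* ι k ℚ.≤ w → 4ℚ ℚ.* ι k ℚ.* η ℚ.≤ w ℚ.* w →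
    ι n ℚ.* (2ℚ ℚ.* η ℚ.+ w) ℚ.≤ (ι n ℚ.* ¼ ℚ.- 8ℚ ℚ.* η) ℚ.* ι m →
    ProbHamAtLeast H m k
  hamiltonian-whp w 2k≤w 4kη≤w² enough =
    likely (minDegree (adj H) (fromℕ< (≤-trans (s≤s z≤n) 3≤n)))
    where
    likely : (∃ λ δ → (∃ λ v → degree (adj H) v ≡ δ) × (∀ v → δ ≤ degree (adj H) v)) →
             ProbHamAtLeast H m k
    likely (δ , (v , deg≡δ) , δ≤deg) =
      let s , eq , 1≤s , ks = trials-suffice n δ m k (2 * pairs n) η w 1≤k (2*pairs n) (1≤2*pairs 3≤n) n/2-η≤δ
            (ℚₚ.≤-trans (ℚₚ.nonNegative⁻¹ ½) ½≤η)
            (e≤N/2 (ι n) (ι m) (ι k) η 0≤n 1≤κ ½≤η η≤) 2k≤w 4kη≤w² enough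
      in Perturbed.hamiltonian-likely H 3≤n δ δ≤deg m k s eq 1≤s ks
      where
      n/2-η≤δ : ι n ℚ.* ½ ℚ.- η ℚ.≤ ι δ
      n/2-η≤δ = subst₂ (λ p d → p ℚ.- η ℚ.≤ ι d) (/≡*1/ n 1) deg≡δ (H-degree v)

  hamiltonian-linear : ι (64 * k + 16) ℚ.* η ℚ.≤ ι m → ProbHamAtLeast H m k
  hamiltonian-linear Kη≤m = hamiltonian-whp (8ℚ ℚ.* ι k ℚ.* η)
    (2κ≤8κe (ι n) (ι m) (ι k) η 0≤n 1≤κ ½≤η η≤)
    (4κe≤[8κe]² (ι n) (ι m) (ι k) η 0≤n 1≤κ ½≤η η≤)
    (enough-linear (ι n) (ι m) (ι k) η 0≤n 1≤κ ½≤η η≤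
      (subst (λ K → K ℚ.* η ℚ.≤ ι m) (trans (ι-+ (64 * k) 16) (cong (ℚ._+ 16ℚ) (ι-* 64 k))) Kη≤m))

  -- The factor 32k is chosen so that the margin l/8 satisfies (l/8)² ≥ 16k²η, which implies both
  -- conditions on the margin.
  hamiltonian-sqrt : ∀ l → 0ℚ ℚ.≤ l → ι (32 * k * (32 * k)) ℚ.* η ℚ.≤ l ℚ.* l →
    (2ℚ ℚ.* η) ÷₀ (¼ ℚ.- (8ℚ ℚ.* η) ÷₀ ι n) ℚ.+ l ℚ.≤ ι m → ProbHamAtLeast H m k
  hamiltonian-sqrt l 0≤l K²η≤l² m-large = hamiltonian-whp (⅛ ℚ.* l)
    (2κ≤l/8 (ι n) (ι m) (ι k) η 0≤n 1≤κ ½≤η η≤ l 0≤l K²η≤l²′)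
    (4κe≤[l/8]² (ι n) (ι m) (ι k) η 0≤n 1≤κ ½≤η η≤ l 0≤l K²η≤l²′)
    (enough-sqrt (ι n) (ι m) (ι k) η 0≤n 1≤κ ½≤η η≤ l 0≤l K²η≤l²′
      p ((2ℚ ℚ.* η) ÷₀ p) n*p 1/8≤p (÷₀-* (2ℚ ℚ.* η) (⅛≤p⇒p≢0 1/8≤p)) m-large)
    where
    K²η≤l²′ : 32ℚ ℚ.* ι k ℚ.* (32ℚ ℚ.* ι k) ℚ.* η ℚ.≤ l ℚ.* l
    K²η≤l²′ = subst (λ K → K ℚ.* η ℚ.≤ l ℚ.* l)
      (trans (ι-* (32 * k) (32 * k)) (cong₂ ℚ._*_ (ι-* 32 k) (ι-* 32 k))) K²η≤l²
    ι≢0 : ι n ≢ 0ℚ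
    ι≢0 eq = contradiction (ι-cancel {n} {0} (ℚₚ.≤-reflexive eq)) (<⇒≱ (≤-trans (s≤s z≤n) 3≤n))
    p : ℚ
    p = ¼ ℚ.- (8ℚ ℚ.* η) ÷₀ ι n
    n*p : ι n ℚ.* p ≡ ι n ℚ.* ¼ ℚ.- 8ℚ ℚ.* η
    n*p = *-[¼-x] (ι n) ((8ℚ ℚ.* η) ÷₀ ι n) (8ℚ ℚ.* η) (÷₀-* (8ℚ ℚ.* η) ι≢0)
    1/8≤p : ⅛ ℚ.≤ p
    1/8≤p = ⅛≤p (ι n) (ι m) (ι k) η 0≤n 1≤κ ½≤η η≤ ι≢0 p n*p

theorem2p1 : (∀ (n₀ : ℕ) (H : (n : ℕ) → SimpleGraph n) (η : ℕ → ℚ) (m : ℕ → ℕ) →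
    StandingHyp n₀ H η m →
    (λ n → ℕ→ℚ (m n)) isω η →
    AAS-Ham H m)
    × (∀ (n₀ : ℕ) (H : (n : ℕ) → SimpleGraph n) (η lam : ℕ → ℚ) (m : ℕ → ℕ) →
    StandingHyp n₀ H η m →
    η isω (λ _ → ℕ→ℚ 1) →
    lam isωSqrt η →
    (∀ n → n₀ ≤ n →
    ((ℤ.+ 2 ℚ./ 1) ℚ.* η n) ÷₀ ((ℤ.+ 1 ℚ./ 4) ℚ.- ((ℤ.+ 8 ℚ./ 1) ℚ.* η n) ÷₀ ℕ→ℚ n) ℚ.+ lam n
    ℚ.≤ ℕ→ℚ (m n)) →
    AAS-Ham H m)
theorem2p1 =
    (λ n₀ H η m hyp m≫η k 1≤k →
      let n₁ , Kη≤m = m≫η (64 * k + 16) in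
      -- The 3 provides the vertices that a Hamiltonian cycle requires.
      n₀ ⊔ n₁ ⊔ 3 , λ n N≤n →
      let deg , ½≤η , η≤ , _ = hyp n (≤n₀ n₀ n₁ N≤n) in
      hamiltonian-linear (H n) (η n) (m n) k (≤n₂ n₀ n₁ N≤n) 1≤k deg ½≤η η≤ (Kη≤m n (≤n₁ n₀ n₁ N≤n)))
  , (λ n₀ H η lam m hyp _ lam≫√η m-large k 1≤k →
      let n₁ , large = lam≫√η (32 * k) in
      n₀ ⊔ n₁ ⊔ 3 , λ n N≤n →
      let deg , ½≤η , η≤ , _ = hyp n (≤n₀ n₀ n₁ N≤n)
          0≤lam , K²η≤lam² = large n (≤n₁ n₀ n₁ N≤n) in
      hamiltonian-sqrt (H n) (η n) (m n) k (≤n₂ n₀ n₁ N≤n) 1≤k deg ½≤η η≤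
        (lam n) 0≤lam K²η≤lam² (m-large n (≤n₀ n₀ n₁ N≤n)))
  where
  ≤n₀ : ∀ a b {n} → a ⊔ b ⊔ 3 ≤ n → a ≤ n
  ≤n₀ a b h = m⊔n≤o⇒m≤o a b (m⊔n≤o⇒m≤o (a ⊔ b) 3 h)
  ≤n₁ : ∀ a b {n} → a ⊔ b ⊔ 3 ≤ n → b ≤ n
  ≤n₁ a b h = m⊔n≤o⇒n≤o a b (m⊔n≤o⇒m≤o (a ⊔ b) 3 h)
  ≤n₂ : ∀ a b {n} → a ⊔ b ⊔ 3 ≤ n → 3 ≤ n
  ≤n₂ a b h = m⊔n≤o⇒n≤o (a ⊔ b) 3 h
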